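{- For every integer $n\ge 0$ and every integer $m$, the number of overpartitions $\vec{\pi}$ of $n$ with $\operatorname{crank1}(\vec{\pi})=m$ equals $\overline{M}(m,n)$, where the integers $\overline{M}(m,n)$ are defined by $$\sum_{n=0}^\infty\sum_{m}\overline{M}(m,n)z^mq^n=\frac{(q^2;q^2)_\infty}{(zq;q)_\infty(z^{ -1}q;q)_\infty}.$$
   Context: Notation: $(a;q)_\infty=\prod_{k=0}^\infty(1-aq^k)$; the generating function is expanded as a formal power series in $q$ whose coefficients are Laurent polynomials in $z$. An overpartition of $n$ is a partition of $n$ in which the first occurrence of each part size may be overlined. It is identified with a pair $\vec{\pi}=(\pi_1,\pi_2)\in\mathcal{PD}\times\mathcal{P}$ with $|\vec\pi|=|\pi_1|+|\pi_2|=n$, where $\mathcal{P}$ is the set of all partitions, $\mathcal{PD}$ is the set of partitions into distinct parts (both sets include the empty partition $\varnothing$), $|\pi|$ is the sum of the parts of $\pi$, $\pi_1$ consists of the overlined parts and $\pi_2$ of the non-overlined parts. For a non-empty partition $\pi$, let $\ell(\pi)$ be its largest part, $\omega(\pi)$ the number of ones in $\pi$, and $\mu(\pi)$ the number of parts of $\pi$ larger than $\omega(\pi)$. The crank is $$\operatorname{crank}(\pi)=\begin{cases}\ell(\pi)&\text{if }\omega(\pi)=0,\\ \mu(\pi)-\omega(\pi)&\text{otherwise.}\end{cases}$$ For a partition $\pi$ into distinct parts define $\lambda(\pi)=0$ if $\pi=\varnothing$ or if $\ell(\pi)$ and $\ell(\pi)-1$ are both parts of $\pi$, and $\lambda(\pi)=1$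 otherwise (in particular $\lambda(\pi)=1$ if $\pi$ has exactly one part, including when $\pi$ is the partition consisting of the single part $1$). For an overpartition $\vec\pi=(\pi_1,\pi_2)\in\mathcal{PD}\times\mathcal{P}$ define $$\operatorname{crank1}(\vec{\pi})=\begin{cases}\operatorname{crank}(\pi_2)&\text{if }\pi_2\ne\varnothing,\\ \lambda(\pi_1)&\text{if }\pi_2=\varnothing.\end{cases}$$ -}

module Defs where

open import Data.Bool.Base using (if_then_else_)
open import Data.Integer as ℤ using (ℤ; +_; -[1+_]; 0ℤ; 1ℤ)
open import Data.List.Base using (List; []; _∷_; _++_; map; filter; foldr; length; cartesianProductWith)
open import Data.List.Extrema.Nat using (max)
open import Data.List.Membership.DecPropositional using (_∈?_)
open import Data.List.Relation.Unary.All using (All)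
open import Data.List.Relation.Unary.Linked using (Linked)
open import Data.Nat.Base using (ℕ; zero; suc; _+_; _∸_; _<_; _≥_; _>_)
open import Data.Nat.ListAction using (sum)
open import Data.Nat.Properties using (_≟_; _<?_)
open import Data.Product.Base using (Σ-syntax; _×_; _,_; proj₁; proj₂)
open import Relation.Binary.PropositionalEquality using (_≡_)
open import Relation.Nullary.Decidable using (does; _×-dec_)

------------------------------------------------------------------------
-- Partitions and overpartitions

-- 𝒫: a partition is its list of parts in weakly decreasing order.
record Partition : Set where
  constructor mkPartition
  field
    parts      : List ℕ
    positive   : All (0 <_) parts
    decreasing : Linked _≥_ parts

-- 𝒫𝒟: the same with strict decrease, so that the parts are distinct.
record DistinctPartition : Set where
  constructor mkDistinctPartition
  field
    parts      : List ℕ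
    positive   : All (0 <_) parts
    decreasing : Linked _>_ parts

-- (π₁ , π₂): overlined parts and non-overlined parts.
Overpartition : Set
Overpartition = DistinctPartition × Partition

size : Overpartition → ℕ
size (π₁ , π₂) = sum (DistinctPartition.parts π₁) + sum (Partition.parts π₂)

------------------------------------------------------------------------
-- The statistics, as functions of the list of parts

largest : List ℕ → ℕ
largest = max 0

ω : List ℕ → ℕ
ω xs = length (filter (_≟ 1) xs)

μ : List ℕ → ℕ
μ xs = length (filter (ω xs <?_) xs)

-- Only meaningful for a non-empty list; crank1 uses it only there.
crank : List ℕ → ℤ
crank xs = if does (ω xs ≟ 0) then + largest xs else + μ xs ℤ.- + ω xs

-- The statistic λ, whose name is reserved. If the largest part ℓ is 1, then
-- ℓ ∸ 1 = 0 is not a part, so the value is 1.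
lam : List ℕ → ℤ
lam []         = 0ℤ
lam xs@(_ ∷ _) =
  let ℓ = largest xs in
  if does (_∈?_ _≟_ ℓ xs ×-dec _∈?_ _≟_ (ℓ ∸ 1) xs) then 0ℤ else 1ℤ

crank1 : Overpartition → ℤ
crank1 (π₁ , π₂) with Partition.parts π₂
... | []         = lam (DistinctPartition.parts π₁)
... | xs@(_ ∷ _) = crank xs

OverpartitionsOf_WithCrank1_ : ℕ → ℤ → Set
OverpartitionsOf n WithCrank1 m =
  Σ[ π ∈ Overpartition ] (size π ≡ n × crank1 π ≡ m)

------------------------------------------------------------------------
-- Laurent polynomials in z over ℤ

-- A list of pairs (c , e) stands for the finite sum of the terms c zᵉ.
-- Exponents may repeat, so a Laurent polynomial is determined by its
-- coefficients [z^ m ] and not by the list.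
Laurent : Set
Laurent = List (ℤ × ℤ)

[z^_] : ℤ → Laurent → ℤ
[z^ m ] p = foldr ℤ._+_ 0ℤ (map proj₁ (filter (λ t → proj₂ t ℤ.≟ m) p))

0ᴸ : Laurent
0ᴸ = []

z^_ : ℤ → Laurent
z^ e = (1ℤ , e) ∷ []

infixl 6 _+ᴸ_
infixl 7 _*ᴸ_

_+ᴸ_ : Laurent → Laurent → Laurent
_+ᴸ_ = _++_

-ᴸ_ : Laurent → Laurent
-ᴸ_ = map λ (c , e) → (ℤ.- c , e)

_*ᴸ_ : Laurent → Laurent → Laurent
_*ᴸ_ = cartesianProductWith λ (c , e) (c′ , e′) → (c ℤ.* c′ , e ℤ.+ e′)

Σᴸ≤ : ℕ → (ℕ → Laurent) → Laurent
Σᴸ≤ zero    f = f 0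
Σᴸ≤ (suc n) f = Σᴸ≤ n f +ᴸ f (suc n)

------------------------------------------------------------------------
-- Formal power series in q over the Laurent polynomials in z

-- f n is the coefficient of qⁿ.
Series : Set
Series = ℕ → Laurent

-- The monomial zᵉ qᵏ.
z^_q^_ : ℤ → ℕ → Series
(z^ e q^ k) n = if does (n ≟ k) then z^ e else 0ᴸ

1ˢ : Series
1ˢ = z^ 0ℤ q^ 0

infixl 6 _-ˢ_
infixl 7 _*ˢ_ _/ˢ_
infixr 8 _^ˢ_

_-ˢ_ : Series → Series → Series
(f -ˢ g) n = f n +ᴸ (-ᴸ g n)

_*ˢ_ : Series → Series → Series
(f *ˢ g) n = Σᴸ≤ n λ i → f i *ᴸ g (n ∸ i)

_^ˢ_ : Series → ℕ → Series
f ^ˢ zero  = 1ˢ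
f ^ˢ suc k = f *ˢ f ^ˢ k

∏ˢ≤ : ℕ → (ℕ → Series) → Series
∏ˢ≤ zero    F = F 0
∏ˢ≤ (suc n) F = ∏ˢ≤ n F *ˢ F (suc n)

-- (a ; b)_∞ = ∏_{k ≥ 0} (1 - a bᵏ), for b without constant term. As bᵏ is
-- then divisible by qᵏ, the factors with k > n are 1 modulo qⁿ⁺¹, and the
-- coefficient of qⁿ in the infinite product is that in ∏_{k ≤ n} (1 - a bᵏ).
⟨_⨾_⟩∞ : Series → Series → Series
⟨ a ⨾ b ⟩∞ n = ∏ˢ≤ n (λ k → 1ˢ -ˢ a *ˢ b ^ˢ k) n

-- 1 / f = Σ_{k ≥ 0} (1 - f)ᵏ, for f with constant term 1. As (1 - f)ᵏ is then
-- divisible by qᵏ, the terms with k > n do not contribute to qⁿ.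
recip : Series → Series
recip f n = Σᴸ≤ n λ k → ((1ˢ -ˢ f) ^ˢ k) n

_/ˢ_ : Series → Series → Series
f /ˢ g = f *ˢ recip g

------------------------------------------------------------------------
-- M̄(m , n)

q q² zq z⁻¹q : Series
q    = z^ 0ℤ q^ 1
q²   = z^ 0ℤ q^ 2
zq   = z^ 1ℤ q^ 1
z⁻¹q = z^ -[1+ 0 ] q^ 1

M̄-series : Series
M̄-series = ⟨ q² ⨾ q² ⟩∞ /ˢ (⟨ zq ⨾ q ⟩∞ *ˢ ⟨ z⁻¹q ⨾ q ⟩∞)

M̄ : ℤ → ℕ → ℤ
M̄ m n = [z^ m ] (M̄-series n)

{-# OPTIONS --safe #-}

-- Splitting off the crank of π₂, the generating function of crank1 is V + D K:
-- V counts distinct partitions by λ, D = (-q;q)_∞ counts them without weight,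
-- and K counts non-empty partitions by the crank.
--
-- Lowering the largest part by one maps the π₁ with λ = 1 bijectively onto all
-- distinct partitions, so V = (1 - q + zq) D. Hence
-- V + D K = D (1 - q + zq + K), and as D (q;q)_∞ = (q²;q²)_∞ it remains to see
-- that 1 - q + zq + K = (q;q)_∞ / ((zq;q)_∞ (z⁻¹q;q)_∞), the crank identity of
-- Andrews and Garvan. Sorted by the number w of ones, K is
--   Σ_{j ≥ 2} zʲqʲ / (q²;q)_{j-1}
--     + Σ_{w ≥ 1} z⁻ʷqʷ / ((q²;q)_{w-1} (zqʷ⁺¹;q)_∞),
-- and both sums are evaluated by the q-binomial theorem
--   Σ_n (a;q)_n tⁿ / (q;q)_n = (at;q)_∞ / (t;q)_∞,
-- with (a , t) = (0 , zq) and (a , t) = (zq , z⁻¹q).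
--
-- For the coefficient of q^N all of this takes place modulo q^(N + 1), where
-- the sums and products are finite.

module Submission where

open import Algebra.Bundles using (CommutativeRing; RawRing)
open import Algebra.Structures using (IsCommutativeRing)
open import Axiom.UniquenessOfIdentityProofs using (module Decidable⇒UIP)
open import Data.Bool.Base using (true; false; if_then_else_)
open import Data.Empty using (⊥)
open import Data.Fin.Base using (Fin; zero; suc)
open import Data.Integer.Base as ℤ using (ℤ; +_; -[1+_]; _⊖_; 0ℤ; 1ℤ)
import Data.Integer.Properties as ℤₚ
open import Data.Integer.Solver using (module +-*-Solver)
open import Data.List.Base
  using (List; []; _∷_; _++_; map; filter; length; lookup; replicate; cartesianProduct)
open import Data.List.Extrema.Nat using (max≈v⁺)
open import Data.List.Membership.DecPropositional using (_∈?_)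
open import Data.List.Membership.Propositional using (_∈_; _∉_)
open import Data.List.Membership.Propositional.Properties
  using (∈-++⁺ˡ; ∈-++⁺ʳ; ∈-++⁻; ∈-map⁺; ∈-map⁻; ∈-cartesianProduct⁺; ∈-cartesianProduct⁻;
         ∈-filter⁺; ∈-filter⁻; ∈-lookup)
import Data.List.Properties as Listₚ
open import Data.List.Relation.Binary.Disjoint.Propositional using (Disjoint)
open import Data.List.Relation.Unary.All as All using (All; []; _∷_)
import Data.List.Relation.Unary.All.Properties as Allₚ
open import Data.List.Relation.Unary.Any as Any using (here; there)
import Data.List.Relation.Unary.Any.Properties as Anyₚ
open import Data.List.Relation.Unary.Linked as Linked using (Linked; []; [-]; _∷_)
import Data.List.Relation.Unary.Linked.Properties as Linkedₚ
open import Data.List.Relation.Unary.Unique.Propositional using (Unique; []; _∷_)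
import Data.List.Relation.Unary.Unique.Propositional.Properties as Uniqueₚ
open import Data.Maybe.Base as Maybe using (Maybe)
open import Data.Nat.Base as ℕ using (ℕ; zero; suc; _∸_; _≤_; _<_; _≥_; _>_; z≤n; s≤s)
open import Data.Nat.ListAction using (sum)
import Data.Nat.Properties as ℕₚ
open import Data.Product.Base using (Σ-syntax; ∃-syntax; _×_; _,_; proj₁; proj₂)
open import Data.Sum.Base using (inj₁; inj₂)
open import Function.Base using (_∘_; case_of_)
open import Function.Bundles using (_↔_; mk↔ₛ′)
open import Level using (0ℓ)
open import Relation.Binary.PropositionalEquality as ≡ using (_≡_; _≢_)
open import Relation.Nullary.Decidable using (does; yes; no; _×-dec_; dec⇒maybe; dec-true; dec-false)
open import Relation.Nullary.Negation using (contradiction)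
open import Defs

-- q-series identities in a commutative ring

-- Both evaluations use the same coefficients, `c′ n` = (1 - q) / (q ; q)ₙ. For n at least 1 this is
-- 1 / (q² ; q)ₙ₋₁, which counts partitions without ones into parts at most n. The terms 0 and 1 of
-- the first series are `1 - q` and `z * q`: the summand 1 - q + zq supplied by V is exactly what K
-- lacks. Multiplied by (zq ; q)∞, the first series leaves just 1 - q, and this is the term 0 of the
-- second series, so the two evaluations link up. In the second one at = zq z⁻¹q = q², and (1 - q)
-- (q² ; q)∞ = (q ; q)∞.
--
-- No division is available in an abstract commutative ring. Every family therefore enters through a
-- recurrence in the largest part allowed, and each identity is proved with its denominators
-- multiplied out. The enumerations by lists satisfy the same recurrences, so algebra and
-- combinatorics meet only in the parameters of `CrankIdentity`.

module ℤCoefficients {c ℓ} (R : CommutativeRing c ℓ) where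

  open CommutativeRing R
  open import Algebra.Properties.Ring ring using (-‿distribˡ-*; -0#≈0#; -‿+-comm; -‿involutive)
  open import Algebra.Properties.Semiring.Mult.TCOptimised semiring
    using (×-homo-+; ×1-homo-*; 1+×) renaming (_×_ to _·_)
  open import Algebra.Solver.Ring.AlmostCommutativeRing
  open import Relation.Binary.Reasoning.Setoid setoid

  -- The ring solver has to compare coefficients, which an arbitrary ring cannot decide; integers
  -- serve as coefficients instead. With the optimised multiple, `fromℤ 1ℤ` reduces to `1#`, so
  -- solved equations mention only `1#`.
  fromℤ : ℤ → Carrier
  fromℤ (+ n)    = n · 1#
  fromℤ -[1+ n ] = - (suc n · 1#)

  fromℤ-⊖ : ∀ m n → fromℤ (m ⊖ n) ≈ m · 1# - n · 1#
  fromℤ-⊖ zero    zero    = sym (-‿inverseʳ 0#)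
  fromℤ-⊖ zero    (suc n) = sym (+-identityˡ _)
  fromℤ-⊖ (suc m) zero    = sym (trans (+-congˡ -0#≈0#) (+-identityʳ _))
  fromℤ-⊖ (suc m) (suc n) = begin
    fromℤ (suc m ⊖ suc n)                        ≡⟨ ≡.cong fromℤ (ℤₚ.[1+m]⊖[1+n]≡m⊖n m n) ⟩
    fromℤ (m ⊖ n)                                ≈⟨ fromℤ-⊖ m n ⟩
    m · 1# - n · 1#                              ≈⟨ +-congˡ (+-identityˡ _) ⟨
    m · 1# + (0# - n · 1#)                       ≈⟨ +-congˡ (+-congʳ (-‿inverseʳ 1#)) ⟨
    m · 1# + ((1# - 1#) - n · 1#)                ≈⟨ +-congˡ (+-assoc _ _ _) ⟩
    m · 1# + (1# + (- 1# - n · 1#))              ≈⟨ +-assoc _ _ _ ⟨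
    (m · 1# + 1#) + (- 1# - n · 1#)              ≈⟨ +-cong (+-comm _ _) (-‿+-comm _ _) ⟩
    (1# + m · 1#) - (1# + n · 1#)                ≈⟨ +-cong (1+× m 1#) (-‿cong (1+× n 1#)) ⟨
    suc m · 1# - suc n · 1#                      ∎

  fromℤ-‿homo : ∀ i → fromℤ (ℤ.- i) ≈ - fromℤ i
  fromℤ-‿homo (+ zero)  = sym -0#≈0#
  fromℤ-‿homo (+ suc n) = refl
  fromℤ-‿homo -[1+ n ]  = sym (-‿involutive _)

  fromℤ-+-homo : ∀ i j → fromℤ (i ℤ.+ j) ≈ fromℤ i + fromℤ j
  fromℤ-+-homo (+ m)    (+ n)    = ×-homo-+ 1# m n
  fromℤ-+-homo (+ m)    -[1+ n ] = fromℤ-⊖ m (suc n)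
  fromℤ-+-homo -[1+ m ] (+ n)    = trans (fromℤ-⊖ n (suc m)) (+-comm _ _)
  fromℤ-+-homo -[1+ m ] -[1+ n ] = begin
    - (suc (suc (m ℕ.+ n)) · 1#)      ≡⟨ ≡.cong (λ k → - (suc k · 1#)) (ℕₚ.+-suc m n) ⟨
    - ((suc m ℕ.+ suc n) · 1#)        ≈⟨ -‿cong (×-homo-+ 1# (suc m) (suc n)) ⟩
    - (suc m · 1# + suc n · 1#)       ≈⟨ -‿+-comm _ _ ⟨
    - (suc m · 1#) - (suc n · 1#)     ∎

  private
    fromℤ-*-homo⁺ : ∀ m j → fromℤ (+ m ℤ.* j) ≈ fromℤ (+ m) * fromℤ j
    fromℤ-*-homo⁺ m (+ n) = begin
      fromℤ (+ m ℤ.* + n)     ≡⟨ ≡.cong fromℤ (ℤₚ.pos-* m n) ⟨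
      fromℤ (+ (m ℕ.* n))     ≈⟨ ×1-homo-* m n ⟩
      fromℤ (+ m) * fromℤ (+ n) ∎
    fromℤ-*-homo⁺ m -[1+ n ] = begin
      fromℤ (+ m ℤ.* -[1+ n ])             ≡⟨ ≡.cong fromℤ (ℤₚ.neg-distribʳ-* (+ m) (+ suc n)) ⟨
      fromℤ (ℤ.- (+ m ℤ.* + suc n))        ≈⟨ fromℤ-‿homo (+ m ℤ.* + suc n) ⟩
      - fromℤ (+ m ℤ.* + suc n)            ≈⟨ -‿cong (fromℤ-*-homo⁺ m (+ suc n)) ⟩
      - (fromℤ (+ m) * fromℤ (+ suc n))    ≈⟨ -‿cong (*-comm _ _) ⟩
      - (fromℤ (+ suc n) * fromℤ (+ m))    ≈⟨ -‿distribˡ-* _ _ ⟩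
      (- fromℤ (+ suc n)) * fromℤ (+ m)    ≈⟨ *-comm _ _ ⟩
      fromℤ (+ m) * (- fromℤ (+ suc n))    ∎

  fromℤ-*-homo : ∀ i j → fromℤ (i ℤ.* j) ≈ fromℤ i * fromℤ j
  fromℤ-*-homo (+ m)    j = fromℤ-*-homo⁺ m j
  fromℤ-*-homo -[1+ m ] j = begin
    fromℤ (-[1+ m ] ℤ.* j)               ≡⟨ ≡.cong fromℤ (ℤₚ.neg-distribˡ-* (+ suc m) j) ⟨
    fromℤ (ℤ.- (+ suc m ℤ.* j))          ≈⟨ fromℤ-‿homo (+ suc m ℤ.* j) ⟩
    - fromℤ (+ suc m ℤ.* j)              ≈⟨ -‿cong (fromℤ-*-homo⁺ (suc m) j) ⟩
    - (fromℤ (+ suc m) * fromℤ j)        ≈⟨ -‿distribˡ-* _ _ ⟩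
    (- fromℤ (+ suc m)) * fromℤ j        ∎

  ℤ-rawRing : RawRing _ _
  ℤ-rawRing = record
    { Carrier = ℤ ; _≈_ = _≡_ ; _+_ = ℤ._+_ ; _*_ = ℤ._*_ ; -_ = ℤ.-_ ; 0# = + 0 ; 1# = + 1 }

  homomorphism : ℤ-rawRing -Raw-AlmostCommutative⟶ fromCommutativeRing R
  homomorphism = record
    { ⟦_⟧    = fromℤ
    ; +-homo = fromℤ-+-homo
    ; *-homo = fromℤ-*-homo
    ; -‿homo = fromℤ-‿homo
    ; 0-homo = refl
    ; 1-homo = refl
    }

  fromℤ-≟ : ∀ i j → Maybe (fromℤ i ≈ fromℤ j)
  fromℤ-≟ i j = Maybe.map (λ { ≡.refl → refl }) (dec⇒maybe (i ℤₚ.≟ j))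

  open import Algebra.Solver.Ring ℤ-rawRing (fromCommutativeRing R) homomorphism fromℤ-≟ public

module Pochhammer {c ℓ} (R : CommutativeRing c ℓ) where

  open CommutativeRing R
  open ℤCoefficients R using (Polynomial; solve; con; _:=_; _:+_; _:-_; _:*_; :-_; _:^_)
  open import Algebra.Properties.Semiring.Exp semiring using (_^_; ^-homo-*; ^-congˡ)
  open import Algebra.Properties.CommutativeSemiring.Exp commutativeSemiring using (^-distrib-*)
  open import Relation.Binary.Reasoning.Setoid setoid

  private
    :1 : ∀ {n} → Polynomial n
    :1 = con (+ 1)

  -- (a ; b)ₙ
  poch : Carrier → Carrier → ℕ → Carrier
  poch a b zero    = 1#
  poch a b (suc n) = poch a b n * (1# - a * b ^ n)

  poch-cong : ∀ {a a′ b b′} → a ≈ a′ → b ≈ b′ → ∀ n → poch a b n ≈ poch a′ b′ n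
  poch-cong a≈ b≈ zero    = refl
  poch-cong a≈ b≈ (suc n) =
    *-cong (poch-cong a≈ b≈ n) (+-congˡ (-‿cong (*-cong a≈ (^-congˡ n b≈))))

  -- `poch` grows at its last factor; this splits off the first one, as needed to pass from (q² ; q)
  -- to (q ; q).
  poch-unfold : ∀ a b n → (1# - a) * poch (a * b) b n ≈ poch a b (suc n)
  poch-unfold a b zero    = solve 1 (λ a → (:1 :- a) :* :1 := :1 :* (:1 :- a :* :1)) refl a
  poch-unfold a b (suc n) = begin
    (1# - a) * (poch (a * b) b n * (1# - a * b * b ^ n))
      ≈⟨ solve 4 (λ a b P B → (:1 :- a) :* (P :* (:1 :- a :* b :* B))
                             := (:1 :- a) :* P :* (:1 :- a :* (b :* B))) refl a b _ (b ^ n) ⟩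
    (1# - a) * poch (a * b) b n * (1# - a * (b * b ^ n))
      ≈⟨ *-congʳ (poch-unfold a b n) ⟩
    poch a b (suc n) * (1# - a * b ^ suc n) ∎

  poch-0 : ∀ {a} b → a ≈ 0# → ∀ n → poch a b n ≈ 1#
  poch-0 b a≈0 zero    = refl
  poch-0 {a} b a≈0 (suc n) = begin
    poch a b n * (1# - a * b ^ n)    ≈⟨ *-cong (poch-0 b a≈0 n) (+-congˡ (-‿cong (*-congʳ a≈0))) ⟩
    1# * (1# - 0# * b ^ n)           ≈⟨ solve 1 (λ B → :1 :* (:1 :- con (+ 0) :* B) := :1) refl _ ⟩
    1#                               ∎

  Σ≤ : ℕ → (ℕ → Carrier) → Carrier
  Σ≤ zero    f = f 0
  Σ≤ (suc n) f = Σ≤ n f + f (suc n)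

  Σ≤-cong : ∀ n {f g} → (∀ i → i ≤ n → f i ≈ g i) → Σ≤ n f ≈ Σ≤ n g
  Σ≤-cong zero    f≈g = f≈g 0 z≤n
  Σ≤-cong (suc n) f≈g =
    +-cong (Σ≤-cong n (λ i i≤n → f≈g i (ℕₚ.m≤n⇒m≤1+n i≤n))) (f≈g (suc n) ℕₚ.≤-refl)

  *-distribʳ-Σ≤ : ∀ n f x → Σ≤ n f * x ≈ Σ≤ n (λ i → f i * x)
  *-distribʳ-Σ≤ zero    f x = refl
  *-distribʳ-Σ≤ (suc n) f x = trans (distribʳ _ _ _) (+-congʳ (*-distribʳ-Σ≤ n f x))

  geometric-sum : ∀ u m → Σ≤ m (u ^_) * (1# - u) ≈ 1# - u ^ suc m
  geometric-sum u zero    = solve 1 (λ u → :1 :* (:1 :- u) := :1 :- u :* :1) refl u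
  geometric-sum u (suc m) = begin
    (Σ≤ m (u ^_) + u ^ suc m) * (1# - u)                 ≈⟨ distribʳ _ _ _ ⟩
    Σ≤ m (u ^_) * (1# - u) + u ^ suc m * (1# - u)        ≈⟨ +-congʳ (geometric-sum u m) ⟩
    1# - u ^ suc m + u ^ suc m * (1# - u)
      ≈⟨ solve 2 (λ u U → :1 :- U :+ U :* (:1 :- u) := :1 :- u :* U) refl u _ ⟩
    1# - u ^ suc (suc m)                                 ∎

  -- As `1# - g` is nilpotent, the geometric series for 1 / g terminates. This is the form in which
  -- `recip` is an inverse.
  geometric-inverse : ∀ g m → (1# - g) ^ suc m ≈ 0# → g * Σ≤ m ((1# - g) ^_) ≈ 1#
  geometric-inverse g m u^≈0 = begin
    g * S                       ≈⟨ solve 2 (λ g S → g :* S := S :* (:1 :- (:1 :- g))) refl g S ⟩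
    S * (1# - (1# - g))         ≈⟨ geometric-sum (1# - g) m ⟩
    1# - (1# - g) ^ suc m       ≈⟨ +-congˡ (-‿cong u^≈0) ⟩
    1# - 0#                     ≈⟨ solve 0 (:1 :- con (+ 0) := :1) refl ⟩
    1#                          ∎
    where S = Σ≤ m ((1# - g) ^_)

  *-inverse-unique : ∀ {f g h r} → g * r ≈ 1# → h * g ≈ f → f * r ≈ h
  *-inverse-unique {f} {g} {h} {r} gr≈1 hg≈f = begin
    f * r          ≈⟨ *-congʳ hg≈f ⟨
    h * g * r      ≈⟨ *-assoc h g r ⟩
    h * (g * r)    ≈⟨ *-congˡ gr≈1 ⟩
    h * 1#         ≈⟨ *-identityʳ h ⟩
    h              ∎

  -- The hypothesis says that cₙ is c₀ / (q ; q)ₙ.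
  module qBinomial (q a : Carrier) (c : ℕ → Carrier)
                   (c-rec : ∀ n → c n ≈ (1# - q ^ suc n) * c (suc n)) where

    F : ℕ → Carrier → Carrier
    F M t = Σ≤ M (λ n → poch a q n * c n * t ^ n)

    F-cong : ∀ M {t t′} → t ≈ t′ → F M t ≈ F M t′
    F-cong M t≈t′ = Σ≤-cong M (λ i _ → *-congˡ (^-congˡ i t≈t′))

    F-0 : ∀ M {t} → t ≈ 0# → F M t ≈ c 0
    F-0 zero    t≈0 = solve 1 (λ c → :1 :* c :* :1 := c) refl _
    F-0 (suc M) {t} t≈0 = begin
      F M t + poch a q (suc M) * c (suc M) * (t * t ^ M)
        ≈⟨ +-cong (F-0 M t≈0) (*-congˡ (*-congʳ t≈0)) ⟩
      c 0 + poch a q (suc M) * c (suc M) * (0# * t ^ M)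
        ≈⟨ solve 3 (λ c P T → c :+ P :* (con (+ 0) :* T) := c) refl (c 0) _ _ ⟩
      c 0 ∎

    -- The classical equation (1 - t) F(t) = (1 - at) F(tq), with the boundary term that truncation
    -- at `M` leaves. In the induction, `c-rec` turns the new coefficient into `c M`, which
    -- reproduces the old boundary term.
    F-functional : ∀ M t → (1# - t) * F M t + poch a q (suc M) * c M * t ^ suc M
                           ≈ (1# - a * t) * F M (t * q)
    F-functional zero    t =
      solve 3 (λ a c t → (:1 :- t) :* (:1 :* c :* :1) :+ :1 :* (:1 :- a :* :1) :* c :* (t :* :1)
                         := (:1 :- a :* t) :* (:1 :* c :* :1)) refl a (c 0) t
    F-functional (suc M) t = begin
      (1# - t) * (F M t + P * C * T) + P * (1# - a * Q) * C * (t * T)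
        ≈⟨ solve 7 (λ a t F P C T Q →
             (:1 :- t) :* (F :+ P :* C :* T) :+ P :* (:1 :- a :* Q) :* C :* (t :* T)
             := ((:1 :- t) :* F :+ P :* ((:1 :- Q) :* C) :* T)
                :+ (:1 :- a :* t) :* (P :* C :* (T :* Q)))
             refl a t (F M t) P C T Q ⟩
      ((1# - t) * F M t + P * ((1# - Q) * C) * T) + (1# - a * t) * (P * C * (T * Q))
        ≈⟨ +-cong (+-congˡ (*-congʳ (*-congˡ (c-rec M)))) (*-congˡ (*-congˡ (^-distrib-* t q (suc M)))) ⟨
      ((1# - t) * F M t + P * c M * T) + (1# - a * t) * (P * C * (t * q) ^ suc M)
        ≈⟨ +-congʳ (F-functional M t) ⟩
      (1# - a * t) * F M (t * q) + (1# - a * t) * (P * C * (t * q) ^ suc M)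
        ≈⟨ distribˡ _ _ _ ⟨
      (1# - a * t) * (F M (t * q) + P * C * (t * q) ^ suc M) ∎
      where P = poch a q (suc M)
            C = c (suc M)
            T = t ^ suc M
            Q = q ^ suc M

    module _ {M : ℕ} {t : Carrier} (t^≈0 : t ^ suc M ≈ 0#) where

      -- Nilpotency of `t` removes the boundary term of `F-functional`, so the truncated series
      -- obeys the exact functional equation at every t qᴷ. Iterating it drives the argument to 0,
      -- where only `c 0` survives.
      F-shift : ∀ K → (1# - t * q ^ K) * F M (t * q ^ K)
                      ≈ (1# - a * t * q ^ K) * F M (t * q ^ suc K)
      F-shift K = begin
        (1# - s) * F M s
          ≈⟨ +-identityʳ _ ⟨
        (1# - s) * F M s + 0#
          ≈⟨ +-congˡ (zeroʳ _) ⟨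
        (1# - s) * F M s + poch a q (suc M) * c M * 0#
          ≈⟨ +-congˡ (*-congˡ s^≈0) ⟨
        (1# - s) * F M s + poch a q (suc M) * c M * s ^ suc M
          ≈⟨ F-functional M s ⟩
        (1# - a * s) * F M (s * q)
          ≈⟨ *-cong (+-congˡ (-‿cong (sym (*-assoc _ _ _))))
                   (F-cong M (trans (*-assoc _ _ _) (*-congˡ (*-comm _ _)))) ⟩
        (1# - a * t * q ^ K) * F M (t * q ^ suc K) ∎
        where
        s = t * q ^ K
        s^≈0 : s ^ suc M ≈ 0#
        s^≈0 = trans (^-distrib-* t (q ^ K) (suc M)) (trans (*-congʳ t^≈0) (zeroˡ _))

      F-iterate : ∀ K → F M t * poch t q K ≈ poch (a * t) q K * F M (t * q ^ K)
      F-iterate zero    = trans (*-comm _ _) (*-congˡ (F-cong M (sym (*-identityʳ t))))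
      F-iterate (suc K) = begin
        F M t * (poch t q K * (1# - t * q ^ K))
          ≈⟨ *-assoc _ _ _ ⟨
        F M t * poch t q K * (1# - t * q ^ K)
          ≈⟨ *-congʳ (F-iterate K) ⟩
        poch (a * t) q K * F M (t * q ^ K) * (1# - t * q ^ K)
          ≈⟨ trans (*-assoc _ _ _) (*-congˡ (*-comm _ _)) ⟩
        poch (a * t) q K * ((1# - t * q ^ K) * F M (t * q ^ K))
          ≈⟨ *-congˡ (F-shift K) ⟩
        poch (a * t) q K * ((1# - a * t * q ^ K) * F M (t * q ^ suc K))
          ≈⟨ *-assoc _ _ _ ⟨
        poch (a * t) q (suc K) * F M (t * q ^ suc K) ∎

      q-binomial : ∀ K → q ^ K ≈ 0# → F M t * poch t q K ≈ poch (a * t) q K * c 0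
      q-binomial K q^K≈0 = trans (F-iterate K)
        (*-congˡ (F-0 M (trans (*-congˡ q^K≈0) (zeroʳ t))))

  -- With all parts at most 1 + b: e b is 1 / (q² ; q)_b, L b is the part of the
  -- sum over j with j ≤ 1 + b, and X w b is the term of K for 1 + w ones.
  module CrankIdentity
    (N : ℕ) (q z y : Carrier) (zy≈1 : z * y ≈ 1#) (q^≈0 : q ^ suc N ≈ 0#)
    (e : ℕ → Carrier) (e-0 : e 0 ≈ 1#)
    (e-suc : ∀ b → e (suc b) ≈ e b + q ^ (2 ℕ.+ b) * e (suc b))
    (L : ℕ → Carrier) (L-0 : L 0 ≈ 0#)
    (L-suc : ∀ b → L (suc b) ≈ L b + (z * q) ^ (2 ℕ.+ b) * e (suc b))
    (X : ℕ → ℕ → Carrier) (X-0 : ∀ w → X w 0 ≈ (y * q) ^ suc w)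
    (X-suc-< : ∀ w b → b < w → X w (suc b) ≈ X w b + q ^ (2 ℕ.+ b) * X w (suc b))
    (X-suc-≥ : ∀ w b → w ≤ b → X w (suc b) ≈ X w b + z * q ^ (2 ℕ.+ b) * X w (suc b))
    (D : ℕ → Carrier) (D-0 : D 0 ≈ 1#)
    (D-suc : ∀ b → D (suc b) ≈ D b + q ^ suc b * D b)
    (V : ℕ → Carrier) (V-1 : V 1 ≈ 1# + z * q)
    (V-suc : ∀ b → V (2 ℕ.+ b) ≈ V (suc b) + q ^ (2 ℕ.+ b) * (z * D b + q ^ suc b * D b))
    where

    -- This is (1 - q) / (q ; q)ₙ. Starting at `1 - q` rather than 1 makes all later values the
    -- partition counts `e`, with no factor 1 / (1 - q) for the ones.
    c′ : ℕ → Carrier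
    c′ zero    = 1# - q
    c′ (suc b) = e b

    -- Allowing a new part any number of times gives a recurrence of the form of the hypothesis; the
    -- conclusion is x′ = x / (1 - u) without division.
    geometric : ∀ {u x x′} → x′ ≈ x + u * x′ → x ≈ (1# - u) * x′
    geometric {u} {x} {x′} eq = begin
      x                       ≈⟨ solve 2 (λ x v → x := (x :+ v) :- v) refl x (u * x′) ⟩
      (x + u * x′) - u * x′   ≈⟨ +-congʳ eq ⟨
      x′ - u * x′             ≈⟨ solve 2 (λ u x → x :- u :* x := (:1 :- u) :* x) refl u x′ ⟩
      (1# - u) * x′           ∎

    c′-rec : ∀ n → c′ n ≈ (1# - q ^ suc n) * c′ (suc n)
    c′-rec zero    = sym (trans (*-congˡ e-0)
      (solve 1 (λ q → (:1 :- q :* :1) :* :1 := :1 :- q) refl q))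
    c′-rec (suc b) = geometric (e-suc b)

    -- Lowering the largest part sends the partitions with λ = 1 and parts at most 1 + b onto the
    -- distinct partitions with parts at most b, the single part 1 going to the empty partition. So
    -- `q * D b` counts those whose weight changes from 1 to z. The proof is by induction on b
    -- instead of by this bijection.
    V-closed : ∀ b → V (suc b) ≈ D (suc b) + (z - 1#) * q * D b
    V-closed zero = begin
      V 1                                    ≈⟨ V-1 ⟩
      1# + z * q                             ≈⟨ solve 2 (λ z q →
        :1 :+ z :* q := :1 :+ (q :* :1) :* :1 :+ (z :- :1) :* q :* :1) refl z q ⟩
      1# + q ^ 1 * 1# + (z - 1#) * q * 1#     ≈⟨ +-cong (+-cong D-0 (*-congˡ D-0)) (*-congˡ D-0) ⟨
      D 0 + q ^ 1 * D 0 + (z - 1#) * q * D 0  ≈⟨ +-congʳ (D-suc 0) ⟨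
      D 1 + (z - 1#) * q * D 0 ∎
    V-closed (suc b) = begin
      V (2 ℕ.+ b)
        ≈⟨ V-suc b ⟩
      V (suc b) + q * Q * (z * D b + Q * D b)
        ≈⟨ +-congʳ (V-closed b) ⟩
      D (suc b) + (z - 1#) * q * D b + q * Q * (z * D b + Q * D b)
        ≈⟨ solve 5 (λ q z Q D D′ → D′ :+ (z :- :1) :* q :* D :+ q :* Q :* (z :* D :+ Q :* D)
             := (D′ :+ (q :* Q) :* (D :+ Q :* D)) :+ (z :- :1) :* q :* (D :+ Q :* D)) refl q z Q (D b) (D (suc b)) ⟩
      (D (suc b) + q * Q * (D b + Q * D b)) + (z - 1#) * q * (D b + Q * D b)
        ≈⟨ +-cong (+-congˡ (*-congˡ (D-suc b))) (*-congˡ (D-suc b)) ⟨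
      (D (suc b) + q * Q * D (suc b)) + (z - 1#) * q * D (suc b)
        ≈⟨ +-congʳ (D-suc (suc b)) ⟨
      D (2 ℕ.+ b) + (z - 1#) * q * D (suc b) ∎
      where Q = q ^ suc b

    -- Factor by factor, (1 + qᵏ) (1 - qᵏ) = 1 - q²ᵏ.
    D-poch : ∀ b → D b * poch q q b ≈ poch (q * q) (q * q) b
    D-poch zero    = trans (*-congʳ D-0) (*-identityˡ _)
    D-poch (suc b) = begin
      D (suc b) * (poch q q b * (1# - q * q ^ b))
        ≈⟨ *-congʳ (D-suc b) ⟩
      (D b + q * q ^ b * D b) * (poch q q b * (1# - q * q ^ b))
        ≈⟨ solve 4 (λ q Q D P → (D :+ q :* Q :* D) :* (P :* (:1 :- q :* Q))
             := D :* P :* (:1 :- q :* q :* (Q :* Q))) refl q (q ^ b) (D b) _ ⟩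
      D b * poch q q b * (1# - q * q * (q ^ b * q ^ b))
        ≈⟨ *-cong (D-poch b) (+-congˡ (-‿cong (*-congˡ (sym (^-distrib-* q q b))))) ⟩
      poch (q * q) (q * q) b * (1# - q * q * (q * q) ^ b) ∎

    -- Each part above the number of ones, `1 + w`, raises the crank by one, so the size k
    -- contributes 1 / (1 - z qᵏ). The two Pochhammer products differ by exactly the factors for k
    -- from 2 + w to 1 + b.
    X-top : ∀ w b → w ≤ b → X w b * poch (z * q) q (suc b) ≈ X w w * poch (z * q) q (suc w)
    X-top w b w≤b with ℕₚ.m≤n⇒m<n∨m≡n w≤b
    X-top w .w      w≤b | inj₂ ≡.refl    = refl
    X-top w (suc b) _   | inj₁ (s≤s w≤b) = begin
      X w (suc b) * (poch (z * q) q (suc b) * (1# - z * q * q ^ suc b))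
        ≈⟨ solve 5 (λ z q Q x P → x :* (P :* (:1 :- z :* q :* Q)) := (:1 :- z :* (q :* Q)) :* x :* P)
             refl z q (q ^ suc b) _ _ ⟩
      (1# - z * q ^ (2 ℕ.+ b)) * X w (suc b) * poch (z * q) q (suc b)
        ≈⟨ *-congʳ (geometric (X-suc-≥ w b w≤b)) ⟨
      X w b * poch (z * q) q (suc b)
        ≈⟨ X-top w b w≤b ⟩
      X w w * poch (z * q) q (suc w) ∎

    -- Sizes from 2 to 1 + b do not exceed the number of ones, hence leave the crank alone and
    -- contribute 1 / (1 - qᵏ), without z.
    X-below : ∀ w b → b ≤ w → X w b * poch (q * q) q b ≈ X w 0
    X-below w zero    _   = *-identityʳ _
    X-below w (suc b) b<w = begin
      X w (suc b) * (poch (q * q) q b * (1# - q * q * q ^ b))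
        ≈⟨ solve 4 (λ q Q x P → x :* (P :* (:1 :- q :* q :* Q)) := (:1 :- q :* (q :* Q)) :* x :* P)
             refl q (q ^ b) _ _ ⟩
      (1# - q ^ (2 ℕ.+ b)) * X w (suc b) * poch (q * q) q b
        ≈⟨ *-congʳ (geometric (X-suc-< w b b<w)) ⟨
      X w b * poch (q * q) q b
        ≈⟨ X-below w b (ℕₚ.<⇒≤ b<w) ⟩
      X w 0 ∎

    -- Makes (q² ; q)_b invertible, so that it can be cancelled from `X-below`.
    e-inverse : ∀ b → poch (q * q) q b * e b ≈ 1#
    e-inverse zero    = trans (*-identityˡ _) e-0
    e-inverse (suc b) = begin
      poch (q * q) q b * (1# - q * q * q ^ b) * e (suc b)
        ≈⟨ solve 4 (λ q Q x P → P :* (:1 :- q :* q :* Q) :* x := P :* ((:1 :- q :* (q :* Q)) :* x))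
             refl q (q ^ b) _ _ ⟩
      poch (q * q) q b * ((1# - q ^ (2 ℕ.+ b)) * e (suc b))
        ≈⟨ *-congˡ (geometric (e-suc b)) ⟨
      poch (q * q) q b * e b
        ≈⟨ e-inverse b ⟩
      1# ∎

    X-diagonal : ∀ w → X w w ≈ e w * (y * q) ^ suc w
    X-diagonal w = begin
      X w w                            ≈⟨ *-identityʳ _ ⟨
      X w w * 1#                       ≈⟨ *-congˡ (e-inverse w) ⟨
      X w w * (poch (q * q) q w * e w) ≈⟨ *-assoc _ _ _ ⟨
      X w w * poch (q * q) q w * e w   ≈⟨ *-congʳ (trans (X-below w w ℕₚ.≤-refl) (X-0 w)) ⟩
      (y * q) ^ suc w * e w            ≈⟨ *-comm _ _ ⟩
      e w * (y * q) ^ suc w            ∎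

    open qBinomial q using (F; q-binomial)

    -- At a = 0 the terms 0 and 1 are `1 - q` and `z * q`; the term j from 2 on is (zq)ʲ / (q² ;
    -- q)ⱼ₋₁, the partitions without ones whose largest part, and so crank, is j.
    Euler : ∀ b → F 0# c′ c′-rec (suc b) (z * q) ≈ 1# - q + z * q + L b
    Euler zero = begin
      1# * (1# - q) * 1# + 1# * (1# - 0# * 1#) * e 0 * (z * q * 1#)
        ≈⟨ +-congˡ (*-congʳ (*-congˡ e-0)) ⟩
      1# * (1# - q) * 1# + 1# * (1# - 0# * 1#) * 1# * (z * q * 1#)
        ≈⟨ solve 2 (λ q zq → :1 :* (:1 :- q) :* :1 :+ :1 :* (:1 :- con (+ 0) :* :1) :* :1 :* (zq :* :1)
             := :1 :- q :+ zq :+ con (+ 0)) refl q (z * q) ⟩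
      1# - q + z * q + 0#
        ≈⟨ +-congˡ L-0 ⟨
      1# - q + z * q + L 0 ∎
    Euler (suc b) = begin
      F 0# c′ c′-rec (suc b) (z * q) + poch 0# q (2 ℕ.+ b) * e (suc b) * (z * q) ^ (2 ℕ.+ b)
        ≈⟨ +-cong (Euler b) (*-congʳ (*-congʳ (poch-0 q refl (2 ℕ.+ b)))) ⟩
      1# - q + z * q + L b + 1# * e (suc b) * (z * q) ^ (2 ℕ.+ b)
        ≈⟨ solve 5 (λ q zq l e t → :1 :- q :+ zq :+ l :+ :1 :* e :* t
             := :1 :- q :+ zq :+ (l :+ t :* e)) refl q (z * q) (L b) (e (suc b)) _ ⟩
      1# - q + z * q + (L b + (z * q) ^ (2 ℕ.+ b) * e (suc b))
        ≈⟨ +-congˡ (L-suc b) ⟨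
      1# - q + z * q + L (suc b) ∎

    xq^≈0 : ∀ x → (x * q) ^ (2 ℕ.+ N) ≈ 0#
    xq^≈0 x = begin
      (x * q) ^ (2 ℕ.+ N)              ≈⟨ ^-distrib-* x q (2 ℕ.+ N) ⟩
      x ^ (2 ℕ.+ N) * (q * q ^ suc N)  ≈⟨ *-congˡ (trans (*-congˡ q^≈0) (zeroʳ q)) ⟩
      x ^ (2 ℕ.+ N) * 0#               ≈⟨ zeroʳ _ ⟩
      0#                               ∎

    Zq Yq : Carrier
    Zq = poch (z * q) q (suc N)
    Yq = poch (y * q) q (suc N)

    Euler-product : (1# - q + z * q + L N) * Zq ≈ 1# - q
    Euler-product = begin
      (1# - q + z * q + L N) * Zq
        ≈⟨ *-congʳ (Euler N) ⟨
      F 0# c′ c′-rec (suc N) (z * q) * Zq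
        ≈⟨ q-binomial 0# c′ c′-rec {suc N} (xq^≈0 z) (suc N) q^≈0 ⟩
      poch (0# * (z * q)) q (suc N) * (1# - q)
        ≈⟨ *-congʳ (poch-0 q (zeroˡ _) (suc N)) ⟩
      1# * (1# - q)
        ≈⟨ *-identityˡ _ ⟩
      1# - q ∎

    G : ℕ → Carrier
    G M = F (z * q) c′ c′-rec M (y * q)

    -- Multiplying by `Zq` clears the denominator (zqʷ⁺²; q) of the term with 1 + w ones and leaves
    -- (zq ; q)_{w+1} as numerator: the term w + 1 of the q-binomial series with a = zq. Its term 0
    -- is the `1 - q` left over by `Euler-product`.
    G-expand : ∀ n → n ≤ N → 1# - q + Σ≤ n (λ w → X w N) * Zq ≈ G (suc n)
    G-expand n n≤N = trans (+-congˡ (*-distribʳ-Σ≤ n _ Zq)) (go n n≤N)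
      where
      summand : ∀ w → w ≤ N → X w N * Zq ≈ poch (z * q) q (suc w) * e w * (y * q) ^ suc w
      summand w w≤N = begin
        X w N * Zq                                       ≈⟨ X-top w N w≤N ⟩
        X w w * poch (z * q) q (suc w)                   ≈⟨ *-congʳ (X-diagonal w) ⟩
        e w * (y * q) ^ suc w * poch (z * q) q (suc w)   ≈⟨ solve 3 (λ e t P → e :* t :* P := P :* e :* t) refl _ _ _ ⟩
        poch (z * q) q (suc w) * e w * (y * q) ^ suc w   ∎
      go : ∀ n → n ≤ N → 1# - q + Σ≤ n (λ w → X w N * Zq) ≈ G (suc n)
      go zero    n≤N = +-cong (solve 1 (λ q → :1 :- q := :1 :* (:1 :- q) :* :1) refl q) (summand 0 n≤N)
      go (suc n) n<N = trans (sym (+-assoc _ _ _)) (+-cong (go n (ℕₚ.<⇒≤ n<N)) (summand (suc n) n<N))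

    K : Carrier
    K = L N + Σ≤ N (λ w → X w N)

    crank-identity : (1# - q + z * q + K) * (Zq * Yq) ≈ poch q q (suc N)
    crank-identity = begin
      (1# - q + z * q + (L N + S)) * (Zq * Yq)
        ≈⟨ solve 5 (λ u l s Z Y → (u :+ (l :+ s)) :* (Z :* Y) := ((u :+ l) :* Z :+ s :* Z) :* Y)
             refl (1# - q + z * q) (L N) S Zq Yq ⟩
      ((1# - q + z * q + L N) * Zq + S * Zq) * Yq
        ≈⟨ *-congʳ (+-congʳ Euler-product) ⟩
      (1# - q + S * Zq) * Yq
        ≈⟨ *-congʳ (G-expand N ℕₚ.≤-refl) ⟩
      G (suc N) * Yq
        ≈⟨ q-binomial (z * q) c′ c′-rec {suc N} (xq^≈0 y) (suc N) q^≈0 ⟩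
      poch (z * q * (y * q)) q (suc N) * (1# - q)
        ≈⟨ *-congʳ (poch-cong zqyq≈qq refl (suc N)) ⟩
      poch (q * q) q (suc N) * (1# - q)
        ≈⟨ *-comm _ _ ⟩
      (1# - q) * poch (q * q) q (suc N)
        ≈⟨ poch-unfold q q (suc N) ⟩
      poch q q (suc N) * (1# - q * q ^ suc N)
        -- There is one factor too many, and modulo q^(N + 1) it is 1.
        ≈⟨ *-congˡ (+-congˡ (-‿cong (*-congˡ q^≈0))) ⟩
      poch q q (suc N) * (1# - q * 0#)
        ≈⟨ solve 2 (λ P q → P :* (:1 :- q :* con (+ 0)) := P) refl _ q ⟩
      poch q q (suc N) ∎
      where
      S = Σ≤ N (λ w → X w N)
      zqyq≈qq : z * q * (y * q) ≈ q * q
      zqyq≈qq = begin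
        z * q * (y * q)  ≈⟨ solve 3 (λ z y q → z :* q :* (y :* q) := z :* y :* (q :* q)) refl z y q ⟩
        z * y * (q * q)  ≈⟨ *-congʳ zy≈1 ⟩
        1# * (q * q)     ≈⟨ *-identityˡ _ ⟩
        q * q            ∎

    -- `D N` and `D (suc N)` agree, since the part N + 1 brings in the vanishing power q^(N + 1);
    -- the closed form of V then factors.
    V-truncated : V (suc N) ≈ D (suc N) * (1# - q + z * q)
    V-truncated = begin
      V (suc N)
        ≈⟨ V-closed N ⟩
      D (suc N) + (z - 1#) * q * D N
        ≈⟨ +-congˡ (+-identityʳ _) ⟨
      D (suc N) + ((z - 1#) * q * D N + 0#)
        ≈⟨ +-congˡ (+-congˡ (trans (*-congʳ (trans (*-congˡ q^≈0) (zeroʳ _))) (zeroˡ _))) ⟨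
      D (suc N) + ((z - 1#) * q * D N + (z - 1#) * q * q ^ suc N * D N)
        ≈⟨ solve 5 (λ z q Q d d′ → d′ :+ ((z :- :1) :* q :* d :+ (z :- :1) :* q :* Q :* d)
             := d′ :+ (z :- :1) :* q :* (d :+ Q :* d)) refl z q (q ^ suc N) (D N) _ ⟩
      D (suc N) + (z - 1#) * q * (D N + q ^ suc N * D N)
        ≈⟨ +-congˡ (*-congˡ (D-suc N)) ⟨
      D (suc N) + (z - 1#) * q * D (suc N)
        ≈⟨ solve 3 (λ z q d → d :+ (z :- :1) :* q :* d := d :* (:1 :- q :+ z :* q)) refl z q _ ⟩
      D (suc N) * (1# - q + z * q) ∎

    overpartition-identity : (V (suc N) + D (suc N) * K) * (Zq * Yq) ≈ poch (q * q) (q * q) (suc N)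
    overpartition-identity = begin
      (V (suc N) + D (suc N) * K) * (Zq * Yq)
        ≈⟨ *-congʳ (+-congʳ V-truncated) ⟩
      (D (suc N) * (1# - q + z * q) + D (suc N) * K) * (Zq * Yq)
        ≈⟨ solve 4 (λ d u k p → (d :* u :+ d :* k) :* p := d :* ((u :+ k) :* p))
             refl (D (suc N)) (1# - q + z * q) K (Zq * Yq) ⟩
      D (suc N) * ((1# - q + z * q + K) * (Zq * Yq))
        ≈⟨ *-congˡ crank-identity ⟩
      D (suc N) * poch q q (suc N)
        ≈⟨ D-poch (suc N) ⟩
      poch (q * q) (q * q) (suc N) ∎

open ≡ using (refl; cong; cong₂; sym; trans; subst; module ≡-Reasoning)

-- Laurent polynomials and power series

-- Pairing with test functions φ : ℤ → ℤ: the coefficient at zᵐ is the pairing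
-- with the indicator function of m.
⟪_⟫ : Laurent → (ℤ → ℤ) → ℤ
⟪ [] ⟫          φ = 0ℤ
⟪ (c , e) ∷ p ⟫ φ = c ℤ.* φ e ℤ.+ ⟪ p ⟫ φ

⟪⟫-cong : ∀ p {φ ψ} → (∀ e → φ e ≡ ψ e) → ⟪ p ⟫ φ ≡ ⟪ p ⟫ ψ
⟪⟫-cong []            φ≗ψ = refl
⟪⟫-cong ((c , e) ∷ p) φ≗ψ = cong₂ ℤ._+_ (cong (c ℤ.*_) (φ≗ψ e)) (⟪⟫-cong p φ≗ψ)

⟪⟫-0 : ∀ p → ⟪ p ⟫ (λ _ → 0ℤ) ≡ 0ℤ
⟪⟫-0 []            = refl
⟪⟫-0 ((c , e) ∷ p) = cong₂ ℤ._+_ (ℤₚ.*-zeroʳ c) (⟪⟫-0 p)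

⟪⟫-+ : ∀ p φ ψ → ⟪ p ⟫ (λ e → φ e ℤ.+ ψ e) ≡ ⟪ p ⟫ φ ℤ.+ ⟪ p ⟫ ψ
⟪⟫-+ []            φ ψ = refl
⟪⟫-+ ((c , e) ∷ p) φ ψ = trans (cong (λ r → c ℤ.* (φ e ℤ.+ ψ e) ℤ.+ r) (⟪⟫-+ p φ ψ))
  (solve 5 (λ c a b r s → c :* (a :+ b) :+ (r :+ s) := (c :* a :+ r) :+ (c :* b :+ s))
    refl c (φ e) (ψ e) (⟪ p ⟫ φ) (⟪ p ⟫ ψ))
  where open +-*-Solver

⟪⟫-* : ∀ p k φ → ⟪ p ⟫ (λ e → k ℤ.* φ e) ≡ k ℤ.* ⟪ p ⟫ φ
⟪⟫-* []            k φ = sym (ℤₚ.*-zeroʳ k)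
⟪⟫-* ((c , e) ∷ p) k φ = trans (cong (λ r → c ℤ.* (k ℤ.* φ e) ℤ.+ r) (⟪⟫-* p k φ))
  (solve 4 (λ c k a r → c :* (k :* a) :+ k :* r := k :* (c :* a :+ r)) refl c k (φ e) (⟪ p ⟫ φ))
  where open +-*-Solver

⟪+ᴸ⟫ : ∀ p r φ → ⟪ p +ᴸ r ⟫ φ ≡ ⟪ p ⟫ φ ℤ.+ ⟪ r ⟫ φ
⟪+ᴸ⟫ []            r φ = sym (ℤₚ.+-identityˡ _)
⟪+ᴸ⟫ ((c , e) ∷ p) r φ = trans (cong (λ r → c ℤ.* φ e ℤ.+ r) (⟪+ᴸ⟫ p r φ)) (sym (ℤₚ.+-assoc (c ℤ.* φ e) _ _))

⟪-ᴸ⟫ : ∀ p φ → ⟪ -ᴸ p ⟫ φ ≡ ℤ.- ⟪ p ⟫ φ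
⟪-ᴸ⟫ []            φ = refl
⟪-ᴸ⟫ ((c , e) ∷ p) φ = trans (cong₂ ℤ._+_ (sym (ℤₚ.neg-distribˡ-* c (φ e))) (⟪-ᴸ⟫ p φ))
  (sym (ℤₚ.neg-distrib-+ (c ℤ.* φ e) _))

⟪*ᴸ⟫ : ∀ p r φ → ⟪ p *ᴸ r ⟫ φ ≡ ⟪ p ⟫ (λ e → ⟪ r ⟫ (λ e′ → φ (e ℤ.+ e′)))
⟪*ᴸ⟫ []            r φ = refl
⟪*ᴸ⟫ ((c , e) ∷ p) r φ = trans
  (⟪+ᴸ⟫ (map (λ (c′ , e′) → c ℤ.* c′ , e ℤ.+ e′) r) (p *ᴸ r) φ)
  (cong₂ ℤ._+_ (row r) (⟪*ᴸ⟫ p r φ))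
  where
  row : ∀ r → ⟪ map (λ (c′ , e′) → c ℤ.* c′ , e ℤ.+ e′) r ⟫ φ ≡ c ℤ.* ⟪ r ⟫ (λ e′ → φ (e ℤ.+ e′))
  row []              = sym (ℤₚ.*-zeroʳ c)
  row ((c′ , e′) ∷ r) = trans (cong₂ ℤ._+_ (ℤₚ.*-assoc c c′ _) (row r)) (sym (ℤₚ.*-distribˡ-+ c _ _))

-- Exchange of two finite sums; commutativity of the product rests on it.
⟪⟫-swap : ∀ p r (φ : ℤ → ℤ → ℤ) →
          ⟪ p ⟫ (λ e → ⟪ r ⟫ (λ e′ → φ e e′)) ≡ ⟪ r ⟫ (λ e′ → ⟪ p ⟫ (λ e → φ e e′))
⟪⟫-swap []            r φ = sym (⟪⟫-0 r)
⟪⟫-swap ((c , e) ∷ p) r φ = trans (cong₂ ℤ._+_ (sym (⟪⟫-* r c (φ e))) (⟪⟫-swap p r φ))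
  (sym (⟪⟫-+ r (λ e′ → c ℤ.* φ e e′) (λ e′ → ⟪ p ⟫ (λ e → φ e e′))))

infix 4 _≈ᴸ_

-- Equality has to ignore the order and the repetition of terms. Testing against all functions, not
-- only indicators, turns a product into an iterated pairing, so the ring laws need no convolution
-- over exponents. The record keeps both sides inferable.
record _≈ᴸ_ (p r : Laurent) : Set where
  constructor mk
  field paired : ∀ φ → ⟪ p ⟫ φ ≡ ⟪ r ⟫ φ
open _≈ᴸ_

Laurent-isCommutativeRing : IsCommutativeRing _≈ᴸ_ _+ᴸ_ _*ᴸ_ -ᴸ_ 0ᴸ (z^ 0ℤ)
Laurent-isCommutativeRing = record
  { isRing = record
    { +-isAbelianGroup = record
      { isGroup = record
        { isMonoid = record
          { isSemigroup = record
            { isMagma = record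
              { isEquivalence = record
                { refl  = mk λ _ → refl
                ; sym   = λ p≈r → mk λ φ → sym (paired p≈r φ)
                ; trans = λ p≈r r≈s → mk λ φ → trans (paired p≈r φ) (paired r≈s φ)
                }
              ; ∙-cong = λ {p} {p′} {r} {r′} p≈p′ r≈r′ → mk λ φ →
                  trans (⟪+ᴸ⟫ p r φ) (trans (cong₂ ℤ._+_ (paired p≈p′ φ) (paired r≈r′ φ)) (sym (⟪+ᴸ⟫ p′ r′ φ)))
              }
            ; assoc = λ p r s → mk λ φ → begin
                ⟪ (p +ᴸ r) +ᴸ s ⟫ φ                 ≡⟨ ⟪+ᴸ⟫ (p +ᴸ r) s φ ⟩
                ⟪ p +ᴸ r ⟫ φ ℤ.+ ⟪ s ⟫ φ            ≡⟨ cong (ℤ._+ ⟪ s ⟫ φ) (⟪+ᴸ⟫ p r φ) ⟩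
                ⟪ p ⟫ φ ℤ.+ ⟪ r ⟫ φ ℤ.+ ⟪ s ⟫ φ     ≡⟨ ℤₚ.+-assoc (⟪ p ⟫ φ) _ _ ⟩
                ⟪ p ⟫ φ ℤ.+ (⟪ r ⟫ φ ℤ.+ ⟪ s ⟫ φ)   ≡⟨ cong (λ x → ⟪ p ⟫ φ ℤ.+ x) (⟪+ᴸ⟫ r s φ) ⟨
                ⟪ p ⟫ φ ℤ.+ ⟪ r +ᴸ s ⟫ φ            ≡⟨ ⟪+ᴸ⟫ p (r +ᴸ s) φ ⟨
                ⟪ p +ᴸ (r +ᴸ s) ⟫ φ                 ∎
            }
          ; identity = (λ _ → mk λ _ → refl) , λ p → mk λ φ → trans (⟪+ᴸ⟫ p [] φ) (ℤₚ.+-identityʳ _)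
          }
        ; inverse =
            (λ p → mk λ φ → trans (⟪+ᴸ⟫ (-ᴸ p) p φ)
               (trans (cong (ℤ._+ ⟪ p ⟫ φ) (⟪-ᴸ⟫ p φ)) (ℤₚ.+-inverseˡ (⟪ p ⟫ φ))))
          , (λ p → mk λ φ → trans (⟪+ᴸ⟫ p (-ᴸ p) φ)
               (trans (cong (λ x → ⟪ p ⟫ φ ℤ.+ x) (⟪-ᴸ⟫ p φ)) (ℤₚ.+-inverseʳ (⟪ p ⟫ φ))))
        ; ⁻¹-cong = λ {p} {r} p≈r → mk λ φ →
            trans (⟪-ᴸ⟫ p φ) (trans (cong ℤ.-_ (paired p≈r φ)) (sym (⟪-ᴸ⟫ r φ)))
        }
      ; comm = λ p r → mk λ φ → trans (⟪+ᴸ⟫ p r φ) (trans (ℤₚ.+-comm (⟪ p ⟫ φ) _) (sym (⟪+ᴸ⟫ r p φ)))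
      }
    ; *-cong = λ {p} {p′} {r} {r′} p≈p′ r≈r′ → mk λ φ → begin
        ⟪ p *ᴸ r ⟫ φ                                        ≡⟨ ⟪*ᴸ⟫ p r φ ⟩
        ⟪ p ⟫ (λ e → ⟪ r ⟫ (λ e′ → φ (e ℤ.+ e′)))           ≡⟨ paired p≈p′ _ ⟩
        ⟪ p′ ⟫ (λ e → ⟪ r ⟫ (λ e′ → φ (e ℤ.+ e′)))          ≡⟨ ⟪⟫-cong p′ (λ e → paired r≈r′ _) ⟩
        ⟪ p′ ⟫ (λ e → ⟪ r′ ⟫ (λ e′ → φ (e ℤ.+ e′)))         ≡⟨ ⟪*ᴸ⟫ p′ r′ φ ⟨
        ⟪ p′ *ᴸ r′ ⟫ φ                                      ∎
    ; *-assoc = λ p r s → mk λ φ → begin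
        ⟪ (p *ᴸ r) *ᴸ s ⟫ φ
          ≡⟨ ⟪*ᴸ⟫ (p *ᴸ r) s φ ⟩
        ⟪ p *ᴸ r ⟫ (λ e → ⟪ s ⟫ (λ e″ → φ (e ℤ.+ e″)))
          ≡⟨ ⟪*ᴸ⟫ p r _ ⟩
        ⟪ p ⟫ (λ e → ⟪ r ⟫ (λ e′ → ⟪ s ⟫ (λ e″ → φ (e ℤ.+ e′ ℤ.+ e″))))
          ≡⟨ ⟪⟫-cong p (λ e → ⟪⟫-cong r (λ e′ → ⟪⟫-cong s (λ e″ → cong φ (ℤₚ.+-assoc e e′ e″)))) ⟩
        ⟪ p ⟫ (λ e → ⟪ r ⟫ (λ e′ → ⟪ s ⟫ (λ e″ → φ (e ℤ.+ (e′ ℤ.+ e″)))))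
          ≡⟨ ⟪⟫-cong p (λ e → ⟪*ᴸ⟫ r s _) ⟨
        ⟪ p ⟫ (λ e → ⟪ r *ᴸ s ⟫ (λ e′ → φ (e ℤ.+ e′)))
          ≡⟨ ⟪*ᴸ⟫ p (r *ᴸ s) φ ⟨
        ⟪ p *ᴸ (r *ᴸ s) ⟫ φ ∎
    ; *-identity = one , λ p → mk λ φ → trans (paired (*-comm p (z^ 0ℤ)) φ) (paired (one p) φ)
    ; distrib =
        (λ s p r → mk λ φ → begin
          ⟪ s *ᴸ (p +ᴸ r) ⟫ φ                    ≡⟨ paired (*-comm s (p +ᴸ r)) φ ⟩
          ⟪ (p +ᴸ r) *ᴸ s ⟫ φ                    ≡⟨ paired (distribʳ s p r) φ ⟩
          ⟪ (p *ᴸ s) +ᴸ (r *ᴸ s) ⟫ φ             ≡⟨ ⟪+ᴸ⟫ (p *ᴸ s) (r *ᴸ s) φ ⟩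
          ⟪ p *ᴸ s ⟫ φ ℤ.+ ⟪ r *ᴸ s ⟫ φ          ≡⟨ cong₂ ℤ._+_ (paired (*-comm p s) φ) (paired (*-comm r s) φ) ⟩
          ⟪ s *ᴸ p ⟫ φ ℤ.+ ⟪ s *ᴸ r ⟫ φ          ≡⟨ ⟪+ᴸ⟫ (s *ᴸ p) (s *ᴸ r) φ ⟨
          ⟪ (s *ᴸ p) +ᴸ (s *ᴸ r) ⟫ φ             ∎)
      , distribʳ
    }
  ; *-comm = *-comm
  }
  where
  open ≡-Reasoning
  *-comm : ∀ p r → p *ᴸ r ≈ᴸ r *ᴸ p
  *-comm p r = mk λ φ → begin
    ⟪ p *ᴸ r ⟫ φ                                ≡⟨ ⟪*ᴸ⟫ p r φ ⟩
    ⟪ p ⟫ (λ e → ⟪ r ⟫ (λ e′ → φ (e ℤ.+ e′)))   ≡⟨ ⟪⟫-swap p r _ ⟩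
    ⟪ r ⟫ (λ e′ → ⟪ p ⟫ (λ e → φ (e ℤ.+ e′)))   ≡⟨ ⟪⟫-cong r (λ e′ → ⟪⟫-cong p (λ e → cong φ (ℤₚ.+-comm e e′))) ⟩
    ⟪ r ⟫ (λ e′ → ⟪ p ⟫ (λ e → φ (e′ ℤ.+ e)))   ≡⟨ ⟪*ᴸ⟫ r p φ ⟨
    ⟪ r *ᴸ p ⟫ φ                                ∎
  distribʳ : ∀ s p r → (p +ᴸ r) *ᴸ s ≈ᴸ (p *ᴸ s) +ᴸ (r *ᴸ s)
  distribʳ s p r = mk λ φ → begin
    ⟪ (p +ᴸ r) *ᴸ s ⟫ φ                     ≡⟨ ⟪*ᴸ⟫ (p +ᴸ r) s φ ⟩
    ⟪ p +ᴸ r ⟫ _                            ≡⟨ ⟪+ᴸ⟫ p r _ ⟩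
    ⟪ p ⟫ _ ℤ.+ ⟪ r ⟫ _                     ≡⟨ cong₂ ℤ._+_ (⟪*ᴸ⟫ p s φ) (⟪*ᴸ⟫ r s φ) ⟨
    ⟪ p *ᴸ s ⟫ φ ℤ.+ ⟪ r *ᴸ s ⟫ φ           ≡⟨ ⟪+ᴸ⟫ (p *ᴸ s) (r *ᴸ s) φ ⟨
    ⟪ (p *ᴸ s) +ᴸ (r *ᴸ s) ⟫ φ              ∎
  one : ∀ p → z^ 0ℤ *ᴸ p ≈ᴸ p
  one p = mk λ φ → begin
    ⟪ z^ 0ℤ *ᴸ p ⟫ φ                              ≡⟨ ⟪*ᴸ⟫ (z^ 0ℤ) p φ ⟩
    1ℤ ℤ.* ⟪ p ⟫ (λ e → φ (0ℤ ℤ.+ e)) ℤ.+ 0ℤ      ≡⟨ ℤₚ.+-identityʳ _ ⟩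
    1ℤ ℤ.* ⟪ p ⟫ (λ e → φ (0ℤ ℤ.+ e))             ≡⟨ ℤₚ.*-identityˡ _ ⟩
    ⟪ p ⟫ (λ e → φ (0ℤ ℤ.+ e))                    ≡⟨ ⟪⟫-cong p (λ e → cong φ (ℤₚ.+-identityˡ e)) ⟩
    ⟪ p ⟫ φ                                       ∎

Laurent-commutativeRing : CommutativeRing 0ℓ 0ℓ
Laurent-commutativeRing = record { isCommutativeRing = Laurent-isCommutativeRing }

module ᴸ = CommutativeRing Laurent-commutativeRing

module ᴸ-Reasoning where
  open import Relation.Binary.Reasoning.Setoid ᴸ.setoid public

[z^]-cong : ∀ {p r} m → p ≈ᴸ r → [z^ m ] p ≡ [z^ m ] r
[z^]-cong {p} {r} m p≈r = trans (sym (indicator p)) (trans (paired p≈r _) (indicator r))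
  where
  δ : ℤ → ℤ
  δ e = if does (e ℤₚ.≟ m) then 1ℤ else 0ℤ
  indicator : ∀ p → ⟪ p ⟫ δ ≡ [z^ m ] p
  indicator []            = refl
  indicator ((c , e) ∷ p) with e ℤₚ.≟ m
  ... | yes _ = cong₂ ℤ._+_ (ℤₚ.*-identityʳ c) (indicator p)
  ... | no  _ = trans (cong₂ ℤ._+_ (ℤₚ.*-zeroʳ c) (indicator p)) (ℤₚ.+-identityˡ _)

Σᴸ≤-cong : ∀ n {f g} → (∀ i → i ≤ n → f i ≈ᴸ g i) → Σᴸ≤ n f ≈ᴸ Σᴸ≤ n g
Σᴸ≤-cong zero    f≈g = f≈g 0 z≤n
Σᴸ≤-cong (suc n) f≈g =
  ᴸ.+-cong (Σᴸ≤-cong n (λ i i≤n → f≈g i (ℕₚ.m≤n⇒m≤1+n i≤n))) (f≈g (suc n) ℕₚ.≤-refl)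

Σᴸ≤-0 : ∀ n {f} → (∀ i → i ≤ n → f i ≈ᴸ 0ᴸ) → Σᴸ≤ n f ≈ᴸ 0ᴸ
Σᴸ≤-0 zero    f≈0 = f≈0 0 z≤n
Σᴸ≤-0 (suc n) f≈0 =
  ᴸ.+-cong (Σᴸ≤-0 n (λ i i≤n → f≈0 i (ℕₚ.m≤n⇒m≤1+n i≤n))) (f≈0 (suc n) ℕₚ.≤-refl)

+ᴸ-interchange : ∀ p r s t → (p +ᴸ r) +ᴸ (s +ᴸ t) ≈ᴸ (p +ᴸ s) +ᴸ (r +ᴸ t)
+ᴸ-interchange = interchange
  where open import Algebra.Properties.CommutativeSemigroup
               (CommutativeRing.+-commutativeSemigroup Laurent-commutativeRing) using (interchange)

Σᴸ≤-+ : ∀ n f g → Σᴸ≤ n (λ i → f i +ᴸ g i) ≈ᴸ Σᴸ≤ n f +ᴸ Σᴸ≤ n g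
Σᴸ≤-+ zero    f g = ᴸ.refl
Σᴸ≤-+ (suc n) f g = ᴸ.trans (ᴸ.+-congʳ (Σᴸ≤-+ n f g)) (+ᴸ-interchange (Σᴸ≤ n f) _ _ _)

Σᴸ≤-suc : ∀ n f → Σᴸ≤ (suc n) f ≈ᴸ f 0 +ᴸ Σᴸ≤ n (f ∘ suc)
Σᴸ≤-suc zero    f = ᴸ.refl
Σᴸ≤-suc (suc n) f = ᴸ.trans (ᴸ.+-congʳ (Σᴸ≤-suc n f)) (ᴸ.+-assoc (f 0) _ _)

-- Convolution of power series, degree by degree

infixl 6 _+ˢ_

_+ˢ_ : Series → Series → Series
(f +ˢ g) n = f n +ᴸ g n

-ˢ_ : Series → Series
(-ˢ f) n = -ᴸ f n

0ˢ : Series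
0ˢ _ = 0ᴸ

*ˢ-cong-at : ∀ n {f f′ g g′} → (∀ i → i ≤ n → f i ≈ᴸ f′ i) → (∀ i → i ≤ n → g i ≈ᴸ g′ i) →
             (f *ˢ g) n ≈ᴸ (f′ *ˢ g′) n
*ˢ-cong-at n f≈f′ g≈g′ = Σᴸ≤-cong n (λ i i≤n → ᴸ.*-cong (f≈f′ i i≤n) (g≈g′ (n ∸ i) (ℕₚ.m∸n≤m n i)))

*ˢ-zeroˡ-at : ∀ n {f} g → (∀ i → i ≤ n → f i ≈ᴸ 0ᴸ) → (f *ˢ g) n ≈ᴸ 0ᴸ
*ˢ-zeroˡ-at n g f≈0 = Σᴸ≤-0 n (λ i i≤n → ᴸ.trans (ᴸ.*-congʳ (f≈0 i i≤n)) (ᴸ.zeroˡ (g (n ∸ i))))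

*ˢ-zeroʳ-at : ∀ n f {g} → (∀ i → i ≤ n → g i ≈ᴸ 0ᴸ) → (f *ˢ g) n ≈ᴸ 0ᴸ
*ˢ-zeroʳ-at n f g≈0 = Σᴸ≤-0 n (λ i i≤n →
  ᴸ.trans (ᴸ.*-congˡ {f i} (g≈0 (n ∸ i) (ℕₚ.m∸n≤m n i))) (ᴸ.zeroʳ (f i)))

*ˢ-sucˡ : ∀ n f g → (f *ˢ g) (suc n) ≈ᴸ f 0 *ᴸ g (suc n) +ᴸ ((f ∘ suc) *ˢ g) n
*ˢ-sucˡ n f g = Σᴸ≤-suc n _

*ˢ-sucʳ : ∀ n f g → (f *ˢ g) (suc n) ≈ᴸ (f *ˢ (g ∘ suc)) n +ᴸ f (suc n) *ᴸ g 0
*ˢ-sucʳ n f g = ᴸ.+-cong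
  (Σᴸ≤-cong n (λ i i≤n → ᴸ.reflexive (cong (λ k → f i *ᴸ g k) (ℕₚ.+-∸-assoc 1 i≤n))))
  (ᴸ.reflexive (cong (λ k → f (suc n) *ᴸ g k) (ℕₚ.n∸n≡0 n)))

-- Splitting off the first term of one product matches splitting off the last term of the other, and
-- what remains has lower degree.
*ˢ-comm-at : ∀ n f g → (f *ˢ g) n ≈ᴸ (g *ˢ f) n
*ˢ-comm-at zero    f g = ᴸ.*-comm (f 0) (g 0)
*ˢ-comm-at (suc n) f g = begin
  (f *ˢ g) (suc n)                             ≈⟨ *ˢ-sucˡ n f g ⟩
  f 0 *ᴸ g (suc n) +ᴸ ((f ∘ suc) *ˢ g) n       ≈⟨ ᴸ.+-cong (ᴸ.*-comm (f 0) _) (*ˢ-comm-at n (f ∘ suc) g) ⟩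
  g (suc n) *ᴸ f 0 +ᴸ (g *ˢ (f ∘ suc)) n       ≈⟨ ᴸ.+-comm (g (suc n) *ᴸ f 0) _ ⟩
  (g *ˢ (f ∘ suc)) n +ᴸ g (suc n) *ᴸ f 0       ≈⟨ *ˢ-sucʳ n g f ⟨
  (g *ˢ f) (suc n)                             ∎
  where open ᴸ-Reasoning

*ˢ-distribʳ-at : ∀ n h f g → ((f +ˢ g) *ˢ h) n ≈ᴸ (f *ˢ h +ˢ g *ˢ h) n
*ˢ-distribʳ-at n h f g =
  ᴸ.trans (Σᴸ≤-cong n (λ i _ → ᴸ.distribʳ (h (n ∸ i)) (f i) (g i))) (Σᴸ≤-+ n _ _)

*ˢ-scale-at : ∀ n p f g → ((λ k → p *ᴸ f k) *ˢ g) n ≈ᴸ p *ᴸ (f *ˢ g) n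
*ˢ-scale-at n p f g = ᴸ.trans (Σᴸ≤-cong n (λ i _ → ᴸ.*-assoc p (f i) _)) (go n)
  where
  go : ∀ m {F} → Σᴸ≤ m (λ i → p *ᴸ F i) ≈ᴸ p *ᴸ Σᴸ≤ m F
  go zero    = ᴸ.refl
  go (suc m) = ᴸ.trans (ᴸ.+-congʳ (go m)) (ᴸ.sym (ᴸ.distribˡ p _ _))

*ˢ-assoc-at : ∀ n f g h → ((f *ˢ g) *ˢ h) n ≈ᴸ (f *ˢ (g *ˢ h)) n
*ˢ-assoc-at zero    f g h = ᴸ.*-assoc (f 0) (g 0) (h 0)
*ˢ-assoc-at (suc n) f g h = begin
  ((f *ˢ g) *ˢ h) (suc n)
    ≈⟨ *ˢ-sucˡ n (f *ˢ g) h ⟩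
  (f 0 *ᴸ g 0) *ᴸ h (suc n) +ᴸ (((f *ˢ g) ∘ suc) *ˢ h) n
    ≈⟨ ᴸ.+-cong (ᴸ.*-assoc (f 0) (g 0) _) (*ˢ-cong-at n {g = h} (λ i _ → *ˢ-sucˡ i f g) (λ i _ → ᴸ.refl)) ⟩
  f 0 *ᴸ (g 0 *ᴸ h (suc n)) +ᴸ (((λ k → f 0 *ᴸ g (suc k)) +ˢ ((f ∘ suc) *ˢ g)) *ˢ h) n
    ≈⟨ ᴸ.+-congˡ (*ˢ-distribʳ-at n h (λ k → f 0 *ᴸ g (suc k)) _) ⟩
  f 0 *ᴸ (g 0 *ᴸ h (suc n)) +ᴸ (((λ k → f 0 *ᴸ g (suc k)) *ˢ h) n +ᴸ (((f ∘ suc) *ˢ g) *ˢ h) n)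
    ≈⟨ ᴸ.+-congˡ {f 0 *ᴸ (g 0 *ᴸ h (suc n))} (ᴸ.+-cong (*ˢ-scale-at n (f 0) (g ∘ suc) h)
         (*ˢ-assoc-at n (f ∘ suc) g h)) ⟩
  f 0 *ᴸ (g 0 *ᴸ h (suc n)) +ᴸ (f 0 *ᴸ ((g ∘ suc) *ˢ h) n +ᴸ ((f ∘ suc) *ˢ (g *ˢ h)) n)
    ≈⟨ ᴸ.+-assoc (f 0 *ᴸ (g 0 *ᴸ h (suc n))) _ _ ⟨
  (f 0 *ᴸ (g 0 *ᴸ h (suc n)) +ᴸ f 0 *ᴸ ((g ∘ suc) *ˢ h) n) +ᴸ ((f ∘ suc) *ˢ (g *ˢ h)) n
    ≈⟨ ᴸ.+-congʳ (ᴸ.distribˡ (f 0) _ _) ⟨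
  f 0 *ᴸ (g 0 *ᴸ h (suc n) +ᴸ ((g ∘ suc) *ˢ h) n) +ᴸ ((f ∘ suc) *ˢ (g *ˢ h)) n
    ≈⟨ ᴸ.+-congʳ {((f ∘ suc) *ˢ (g *ˢ h)) n} (ᴸ.*-congˡ {f 0} (*ˢ-sucˡ n g h)) ⟨
  f 0 *ᴸ (g *ˢ h) (suc n) +ᴸ ((f ∘ suc) *ˢ (g *ˢ h)) n
    ≈⟨ *ˢ-sucˡ n f (g *ˢ h) ⟨
  (f *ˢ (g *ˢ h)) (suc n) ∎
  where open ᴸ-Reasoning

monomial-0-* : ∀ e f n → ((z^ e q^ 0) *ˢ f) n ≈ᴸ z^ e *ᴸ f n
monomial-0-* e f zero    = ᴸ.refl
monomial-0-* e f (suc n) = begin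
  ((z^ e q^ 0) *ˢ f) (suc n)                   ≈⟨ *ˢ-sucˡ n (z^ e q^ 0) f ⟩
  z^ e *ᴸ f (suc n) +ᴸ (0ˢ *ˢ f) n             ≈⟨ ᴸ.+-congˡ (*ˢ-zeroˡ-at n f (λ i _ → ᴸ.refl)) ⟩
  z^ e *ᴸ f (suc n) +ᴸ 0ᴸ                      ≈⟨ ᴸ.+-identityʳ _ ⟩
  z^ e *ᴸ f (suc n)                            ∎
  where open ᴸ-Reasoning

monomial-* : ∀ d j e k n → ((z^ d q^ j) *ˢ (z^ e q^ k)) n ≈ᴸ (z^ (d ℤ.+ e) q^ (j ℕ.+ k)) n
monomial-* d zero e k n = ᴸ.trans (monomial-0-* d (z^ e q^ k) n) shift
  where
  shift : z^ d *ᴸ (z^ e q^ k) n ≈ᴸ (z^ (d ℤ.+ e) q^ k) n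
  shift with n ℕ.≡ᵇ k
  ... | true  = ᴸ.refl
  ... | false = ᴸ.refl
monomial-* d (suc j) e k zero    = ᴸ.refl
monomial-* d (suc j) e k (suc n) =
  ᴸ.trans (*ˢ-sucˡ n (z^ d q^ suc j) (z^ e q^ k)) (monomial-* d j e k n)

monomial-vanish : ∀ e k n → n < k → (z^ e q^ k) n ≈ᴸ 0ᴸ
monomial-vanish e (suc k) zero    _         = ᴸ.refl
monomial-vanish e (suc k) (suc n) (s≤s n<k) = monomial-vanish e k n n<k

^ˢ-vanish : ∀ {u} → u 0 ≈ᴸ 0ᴸ → ∀ k n → n < k → (u ^ˢ k) n ≈ᴸ 0ᴸ
^ˢ-vanish {u} u0≈0 (suc k) zero    _         = ᴸ.trans (ᴸ.*-congʳ u0≈0) (ᴸ.zeroˡ ((u ^ˢ k) 0))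
^ˢ-vanish {u} u0≈0 (suc k) (suc n) (s≤s n<k) = begin
  (u *ˢ u ^ˢ k) (suc n)                                   ≈⟨ *ˢ-sucˡ n u (u ^ˢ k) ⟩
  u 0 *ᴸ (u ^ˢ k) (suc n) +ᴸ ((u ∘ suc) *ˢ u ^ˢ k) n      ≈⟨ ᴸ.+-cong
    (ᴸ.trans (ᴸ.*-congʳ u0≈0) (ᴸ.zeroˡ ((u ^ˢ k) (suc n))))
    (*ˢ-zeroʳ-at n (u ∘ suc) (λ i i≤n → ^ˢ-vanish {u} u0≈0 k i (ℕₚ.≤-<-trans i≤n n<k))) ⟩
  0ᴸ                                                      ∎
  where open ᴸ-Reasoning

1-g≈0 : ∀ g → g 0 ≈ᴸ z^ 0ℤ → (1ˢ -ˢ g) 0 ≈ᴸ 0ᴸ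
1-g≈0 g g0≈1 = ᴸ.trans (ᴸ.+-congˡ {z^ 0ℤ} (ᴸ.-‿cong g0≈1)) (ᴸ.-‿inverseʳ (z^ 0ℤ))

-- The ring of power series modulo q^(N + 1).
module Truncated (N : ℕ) where

  infix 4 _≈ˢ_

  record _≈ˢ_ (f g : Series) : Set where
    constructor mk
    field coefficient : ∀ n → n ≤ N → f n ≈ᴸ g n
  open _≈ˢ_ public

  isCommutativeRing : IsCommutativeRing _≈ˢ_ _+ˢ_ _*ˢ_ -ˢ_ 0ˢ 1ˢ
  isCommutativeRing = record
    { isRing = record
      { +-isAbelianGroup = record
        { isGroup = record
          { isMonoid = record
            { isSemigroup = record
              { isMagma = record
                { isEquivalence = record
                  { refl  = mk λ _ _ → ᴸ.refl
                  ; sym   = λ f≈g → mk λ n n≤N → ᴸ.sym (coefficient f≈g n n≤N)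
                  ; trans = λ f≈g g≈h → mk λ n n≤N → ᴸ.trans (coefficient f≈g n n≤N) (coefficient g≈h n n≤N)
                  }
                ; ∙-cong = λ f≈f′ g≈g′ → mk λ n n≤N → ᴸ.+-cong (coefficient f≈f′ n n≤N) (coefficient g≈g′ n n≤N)
                }
              ; assoc = λ f g h → mk λ n _ → ᴸ.+-assoc (f n) (g n) (h n)
              }
            ; identity = (λ f → mk λ n _ → ᴸ.+-identityˡ (f n)) , (λ f → mk λ n _ → ᴸ.+-identityʳ (f n))
            }
          ; inverse = (λ f → mk λ n _ → ᴸ.-‿inverseˡ (f n)) , (λ f → mk λ n _ → ᴸ.-‿inverseʳ (f n))
          ; ⁻¹-cong = λ f≈g → mk λ n n≤N → ᴸ.-‿cong (coefficient f≈g n n≤N)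
          }
        ; comm = λ f g → mk λ n _ → ᴸ.+-comm (f n) (g n)
        }
      ; *-cong = λ f≈f′ g≈g′ → mk λ n n≤N → *ˢ-cong-at n
          (λ i i≤n → coefficient f≈f′ i (ℕₚ.≤-trans i≤n n≤N))
          (λ i i≤n → coefficient g≈g′ i (ℕₚ.≤-trans i≤n n≤N))
      ; *-assoc = λ f g h → mk λ n _ → *ˢ-assoc-at n f g h
      ; *-identity = (λ f → mk λ n _ → one n f)
                   , (λ f → mk λ n _ → ᴸ.trans (*ˢ-comm-at n f 1ˢ) (one n f))
      ; distrib =
          (λ h f g → mk λ n _ → ᴸ.trans (*ˢ-comm-at n h (f +ˢ g)) (ᴸ.trans (*ˢ-distribʳ-at n h f g)
             (ᴸ.+-cong (*ˢ-comm-at n f h) (*ˢ-comm-at n g h))))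
        , (λ h f g → mk λ n _ → *ˢ-distribʳ-at n h f g)
      }
    ; *-comm = λ f g → mk λ n _ → *ˢ-comm-at n f g
    }
    where
    one : ∀ n f → (1ˢ *ˢ f) n ≈ᴸ f n
    one n f = ᴸ.trans (monomial-0-* 0ℤ f n) (ᴸ.*-identityˡ (f n))

  commutativeRing : CommutativeRing 0ℓ 0ℓ
  commutativeRing = record { isCommutativeRing = isCommutativeRing }

*ˢ-1-at : ∀ n f {g} → (∀ i → i ≤ n → g i ≈ᴸ 1ˢ i) → (f *ˢ g) n ≈ᴸ f n
*ˢ-1-at n f g≈1 = ᴸ.trans (*ˢ-cong-at n {f = f} (λ _ _ → ᴸ.refl) g≈1) (coefficient (*-identityʳ f) n ℕₚ.≤-refl)
  where open Truncated n
        open CommutativeRing commutativeRing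

-- Infinite products and reciprocals are cut off at the very degree being read. This trades the
-- moving cutoff for the fixed `N`, so that they become finite expressions in the truncated ring.
stable-≤ : ∀ n (f : ℕ → Laurent) → (∀ m → n ≤ m → f (suc m) ≈ᴸ f m) → ∀ m → n ≤ m → f n ≈ᴸ f m
stable-≤ n f step m n≤m with ℕₚ.m≤n⇒m<n∨m≡n n≤m
... | inj₂ refl = ᴸ.refl
stable-≤ n f step (suc m) _ | inj₁ (s≤s n≤m) =
  ᴸ.trans (stable-≤ n f step m n≤m) (ᴸ.sym (step m n≤m))

module Quotients (N : ℕ) where

  open Truncated N
  open CommutativeRing commutativeRing hiding (refl; sym; trans)
  module ˢ = CommutativeRing commutativeRing
  open Pochhammer commutativeRing using (poch; Σ≤; geometric-inverse; *-inverse-unique)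
  open import Algebra.Properties.Semiring.Exp semiring using (_^_)

  ^ˢ≡^ : ∀ f k → f ^ˢ k ≡ f ^ k
  ^ˢ≡^ f zero    = refl
  ^ˢ≡^ f (suc k) = cong (f *ˢ_) (^ˢ≡^ f k)

  -- The index is `suc N` because the product over k from 0 to N has N + 1 factors.
  ⟨⨾⟩∞≈poch : ∀ a b → b 0 ≈ᴸ 0ᴸ → ⟨ a ⨾ b ⟩∞ ≈ˢ poch a b (suc N)
  ⟨⨾⟩∞≈poch a b b0≈0 = ˢ.trans
    (mk λ n n≤N → stable-≤ n (λ m → ∏ˢ≤ m factor n) (step n) N n≤N)
    (finite N)
    where
    factor : ℕ → Series
    factor k = 1ˢ -ˢ a *ˢ b ^ˢ k
    factor≈1 : ∀ k i → i < k → factor k i ≈ᴸ 1ˢ i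
    factor≈1 k i i<k = ᴸ.trans
      (ᴸ.+-congˡ {1ˢ i} (ᴸ.-‿cong (*ˢ-zeroʳ-at i a (λ j j≤i → ^ˢ-vanish {b} b0≈0 k j (ℕₚ.≤-<-trans j≤i i<k)))))
      (ᴸ.+-identityʳ (1ˢ i))
    step : ∀ n m → n ≤ m → ∏ˢ≤ (suc m) factor n ≈ᴸ ∏ˢ≤ m factor n
    step n m n≤m = *ˢ-1-at n (∏ˢ≤ m factor) (λ i i≤n → factor≈1 (suc m) i (s≤s (ℕₚ.≤-trans i≤n n≤m)))
    factor≈ : ∀ k → factor k ≈ˢ 1ˢ - a * b ^ k
    factor≈ k = ˢ.reflexive (cong (λ p → 1ˢ -ˢ a *ˢ p) (^ˢ≡^ b k))
    finite : ∀ m → ∏ˢ≤ m factor ≈ˢ poch a b (suc m)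
    finite zero    = ˢ.trans (factor≈ 0) (ˢ.sym (*-identityˡ _))
    finite (suc m) = *-cong (finite m) (factor≈ (suc m))

  recip≈Σ : ∀ g → g 0 ≈ᴸ z^ 0ℤ → recip g ≈ˢ Σ≤ N ((1# - g) ^_)
  recip≈Σ g g0≈1 = mk λ n n≤N → ᴸ.trans
      (stable-≤ n (λ m → Σᴸ≤ m (λ k → (u ^ˢ k) n))
        (λ m n≤m → ᴸ.trans (ᴸ.+-congˡ {Σᴸ≤ m (λ k → (u ^ˢ k) n)} (^ˢ-vanish {u} u0≈0 (suc m) n (s≤s n≤m)))
                     (ᴸ.+-identityʳ _)) N n≤N)
      (ᴸ.reflexive (Σ-at N n))
    where
    u : Series
    u = 1ˢ -ˢ g
    u0≈0 : u 0 ≈ᴸ 0ᴸ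
    u0≈0 = 1-g≈0 g g0≈1
    Σ-at : ∀ m n → Σᴸ≤ m (λ k → (u ^ˢ k) n) ≡ Σ≤ m (u ^_) n
    Σ-at zero    n = refl
    Σ-at (suc m) n = cong₂ _+ᴸ_ (Σ-at m n) (cong (λ f → f n) (^ˢ≡^ u (suc m)))

  -- `1ˢ -ˢ g` has no constant term and so is nilpotent modulo q^(N + 1); `recip g` is then a true
  -- inverse and a quotient can be checked by multiplication.
  /ˢ-unique : ∀ f g h → g 0 ≈ᴸ z^ 0ℤ → h *ˢ g ≈ˢ f → f /ˢ g ≈ˢ h
  /ˢ-unique f g h g0≈1 = *-inverse-unique {f} {g} {h} {recip g} (ˢ.trans
    (*-cong {g} {g} ˢ.refl (recip≈Σ g g0≈1))
    (geometric-inverse g N (ˢ.trans (ˢ.reflexive (sym (^ˢ≡^ (1ˢ -ˢ g) (suc N))))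
      (mk λ n n≤N → ^ˢ-vanish {1ˢ -ˢ g} (1-g≈0 g g0≈1) (suc N) n (s≤s n≤N)))))

-- Enumeration of overpartitions

open import Data.Nat.Base using (_+_)

Parts : Set
Parts = List ℕ

-- Multiplication by qᵏ, on families of lists indexed by size.
shift : ∀ {A : Set} → ℕ → (ℕ → List A) → ℕ → List A
shift zero    f n       = f n
shift (suc k) f zero    = []
shift (suc k) f (suc n) = shift k f n

∈-shift⁺ : ∀ {A : Set} k {f} m {x : A} → x ∈ f m → x ∈ shift k f (k + m)
∈-shift⁺ zero    m x∈ = x∈
∈-shift⁺ (suc k) m x∈ = ∈-shift⁺ k m x∈

∈-shift⁻ : ∀ {A : Set} k {f} n {x : A} → x ∈ shift k f n → ∃[ m ] n ≡ k + m × x ∈ f m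
∈-shift⁻ zero    n       x∈ = n , refl , x∈
∈-shift⁻ (suc k) (suc n) x∈ with ∈-shift⁻ k n x∈
... | m , refl , x∈f = m , refl , x∈f

shift-unique : ∀ {A : Set} k {f : ℕ → List A} n → (∀ m → Unique (f m)) → Unique (shift k f n)
shift-unique zero    n       f! = f! n
shift-unique (suc k) zero    f! = []
shift-unique (suc k) (suc n) f! = shift-unique k n f!

shift-cong : ∀ {A : Set} k {f g : ℕ → List A} n → (∀ m → k + m ≤ n → f m ≡ g m) → shift k f n ≡ shift k g n
shift-cong zero    n       f≡g = f≡g n ℕₚ.≤-refl
shift-cong (suc k) zero    f≡g = refl
shift-cong (suc k) (suc n) f≡g = shift-cong k n (λ m k+m≤n → f≡g m (s≤s k+m≤n))

[_]₀ : ∀ {A : Set} → A → ℕ → List A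
[ x ]₀ zero    = x ∷ []
[ x ]₀ (suc n) = []

single : ∀ {A : Set} → ℕ → A → ℕ → List A
single k x = shift k [ x ]₀

∈-single⁺ : ∀ {A : Set} k {x : A} → x ∈ single k x k
∈-single⁺ zero    = here refl
∈-single⁺ (suc k) = ∈-single⁺ k

∈-single⁻ : ∀ {A : Set} k {x y : A} n → y ∈ single k x n → n ≡ k × y ≡ x
∈-single⁻ zero    zero    (here y≡x) = refl , y≡x
∈-single⁻ (suc k) (suc n) y∈ with ∈-single⁻ k n y∈
... | refl , y≡x = refl , y≡x

single-unique : ∀ {A : Set} k {x : A} n → Unique (single k x n)
single-unique k n = shift-unique k n λ { zero → [] ∷ [] ; (suc _) → [] }

prepend : ℕ → (ℕ → List Parts) → ℕ → List Parts
prepend d g = shift d (map (d ∷_) ∘ g)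

∈-prepend⁺ : ∀ d {g} m {xs} → xs ∈ g m → d ∷ xs ∈ prepend d g (d + m)
∈-prepend⁺ d m xs∈ = ∈-shift⁺ d m (∈-map⁺ (d ∷_) xs∈)

∈-prepend⁻ : ∀ d {g} n {xs} → xs ∈ prepend d g n →
             ∃[ m ] ∃[ ys ] n ≡ d + m × xs ≡ d ∷ ys × ys ∈ g m
∈-prepend⁻ d {g} n xs∈ with ∈-shift⁻ d {map (d ∷_) ∘ g} n xs∈
... | m , n≡ , xs∈m with ∈-map⁻ (d ∷_) xs∈m
...   | ys , ys∈ , xs≡ = m , ys , n≡ , xs≡ , ys∈

prepend-unique : ∀ d {g} n → (∀ m → Unique (g m)) → Unique (prepend d g n)
prepend-unique d n g! = shift-unique d n (λ m → Uniqueₚ.map⁺ Listₚ.∷-injectiveʳ (g! m))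

prepend-cong : ∀ d {f g} n → (∀ m → d + m ≤ n → f m ≡ g m) → prepend d f n ≡ prepend d g n
prepend-cong d n f≡g = shift-cong d n (λ m d+m≤n → cong (map (d ∷_)) (f≡g m d+m≤n))

-- The first argument is fuel: the size drops by d at each copy, which is not a structural descent.
repeatedUpTo : ℕ → ℕ → (ℕ → List Parts) → ℕ → List Parts
repeatedUpTo zero    d f n = f n
repeatedUpTo (suc k) d f n = f n ++ prepend d (repeatedUpTo k d f) n

-- Prepends d any number of times; for d ≥ 1, n bounds the number of copies.
repeated : ℕ → (ℕ → List Parts) → ℕ → List Parts
repeated d f n = repeatedUpTo n d f n

-- Each copy of the positive part `suc b` uses up at least one unit of size, so fuel beyond n has no
-- effect.
repeatedUpTo-irrelevant : ∀ b f n k l → n ≤ k → n ≤ l →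
                          repeatedUpTo k (suc b) f n ≡ repeatedUpTo l (suc b) f n
repeatedUpTo-irrelevant b f n    zero    zero    _   _   = refl
repeatedUpTo-irrelevant b f zero zero    (suc l) _   _   = sym (Listₚ.++-identityʳ (f 0))
repeatedUpTo-irrelevant b f zero (suc k) zero    _   _   = Listₚ.++-identityʳ (f 0)
repeatedUpTo-irrelevant b f n    (suc k) (suc l) n≤k n≤l =
  cong (f n ++_) (prepend-cong (suc b) n λ m d+m≤n → repeatedUpTo-irrelevant b f m k l
    (ℕ.s≤s⁻¹ (ℕₚ.≤-trans (s≤s (ℕₚ.m≤n+m m b)) (ℕₚ.≤-trans d+m≤n n≤k)))
    (ℕ.s≤s⁻¹ (ℕₚ.≤-trans (s≤s (ℕₚ.m≤n+m m b)) (ℕₚ.≤-trans d+m≤n n≤l))))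

-- The list form of x′ = x + qᵈ x′, from which the recurrences for `e` and `X` are read off.
repeated-unfold : ∀ b f n → repeated (suc b) f n ≡ f n ++ prepend (suc b) (repeated (suc b) f) n
repeated-unfold b f n = trans
  (repeatedUpTo-irrelevant b f n n (suc n) ℕₚ.≤-refl (ℕₚ.n≤1+n n))
  (cong (f n ++_) (prepend-cong (suc b) n λ m d+m≤n → repeatedUpTo-irrelevant b f m n m
    (ℕₚ.≤-trans (ℕₚ.m≤n+m m (suc b)) d+m≤n) ℕₚ.≤-refl))

repeated-induction : ∀ d f (P : ℕ → Parts → Set) → (∀ n xs → xs ∈ f n → P n xs) →
                     (∀ n xs → P n xs → P (d + n) (d ∷ xs)) →
                     ∀ n xs → xs ∈ repeated d f n → P n xs
repeated-induction d f P base step n = go n n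
  where
  go : ∀ k n xs → xs ∈ repeatedUpTo k d f n → P n xs
  go zero    n xs xs∈ = base n xs xs∈
  go (suc k) n xs xs∈ with ∈-++⁻ (f n) xs∈
  ... | inj₁ xs∈f = base n xs xs∈f
  ... | inj₂ xs∈p with ∈-prepend⁻ d n xs∈p
  ...   | m , ys , refl , refl , ys∈ = step m ys (go k m ys ys∈)

++-prepend-unique : ∀ d {f g : ℕ → List Parts} n → (∀ m → Unique (f m)) → (∀ m → Unique (g m)) →
                    (∀ xs → d ∷ xs ∉ f n) →
                    Unique (f n ++ prepend d g n)
++-prepend-unique d {f} {g} n f! g! d∉f = Uniqueₚ.++⁺ {xs = f n} (f! n) (prepend-unique d {g} n g!) disjoint
  where
  disjoint : Disjoint (f n) (prepend d g n)
  disjoint (xs∈f , xs∈p) with ∈-prepend⁻ d n xs∈p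
  ... | m , ys , _ , refl , _ = d∉f ys xs∈f

repeated-unique : ∀ d f n → (∀ m → Unique (f m)) → (∀ m xs → d ∷ xs ∉ f m) →
                  Unique (repeated d f n)
repeated-unique d f n f! d∉f = go n n
  where
  go : ∀ k n → Unique (repeatedUpTo k d f n)
  go zero    n = f! n
  go (suc k) n = ++-prepend-unique d {f} n f! (go k) (d∉f n)

⋃≤ : ∀ {A : Set} → ℕ → (ℕ → List A) → List A
⋃≤ zero    f = f 0
⋃≤ (suc n) f = ⋃≤ n f ++ f (suc n)

∈-⋃≤⁺ : ∀ {A : Set} n {f} {x : A} i → i ≤ n → x ∈ f i → x ∈ ⋃≤ n f
∈-⋃≤⁺ zero    zero _   x∈ = x∈
∈-⋃≤⁺ (suc n) {f} i i≤n x∈ with ℕₚ.m≤n⇒m<n∨m≡n i≤n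
... | inj₁ (s≤s i≤n′) = ∈-++⁺ˡ (∈-⋃≤⁺ n i i≤n′ x∈)
... | inj₂ refl       = ∈-++⁺ʳ (⋃≤ n f) x∈

∈-⋃≤⁻ : ∀ {A : Set} n f {x : A} → x ∈ ⋃≤ n f → ∃[ i ] i ≤ n × x ∈ f i
∈-⋃≤⁻ zero    f x∈ = 0 , z≤n , x∈
∈-⋃≤⁻ (suc n) f x∈ with ∈-++⁻ (⋃≤ n f) x∈
... | inj₂ x∈f = suc n , ℕₚ.≤-refl , x∈f
... | inj₁ x∈⋃ with ∈-⋃≤⁻ n f x∈⋃
...   | i , i≤n , x∈f = i , ℕₚ.m≤n⇒m≤1+n i≤n , x∈f

⋃≤-unique : ∀ {A : Set} n (f : ℕ → List A) → (∀ i → Unique (f i)) →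
            (∀ i j {x} → x ∈ f i → x ∈ f j → i ≡ j) → Unique (⋃≤ n f)
⋃≤-unique zero    f f! inj = f! 0
⋃≤-unique (suc n) f f! inj = Uniqueₚ.++⁺ (⋃≤-unique n f f! inj) (f! (suc n)) disjoint
  where
  disjoint : Disjoint (⋃≤ n f) (f (suc n))
  disjoint (x∈⋃ , x∈f) with ∈-⋃≤⁻ n f x∈⋃
  ... | i , i≤n , x∈i = ℕₚ.<⇒≢ (s≤s i≤n) (inj i (suc n) x∈i x∈f)

-- The partitions of n into parts ≤ 1 + b, exactly w of which are ones.
withOnes : ℕ → ℕ → ℕ → List Parts
withOnes w zero    = single w (replicate w 1)
withOnes w (suc b) = repeated (2 + b) (withOnes w b)

-- The non-empty partitions of n into parts ≤ 1 + b, none of which is 1.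
withoutOnes : ℕ → ℕ → List Parts
withoutOnes zero    n = []
withoutOnes (suc b) n = withoutOnes b n ++ prepend (2 + b) (withOnes 0 (suc b)) n

-- The partitions of n into distinct parts ≤ b.
distinct : ℕ → ℕ → List Parts
distinct zero    = single 0 []
distinct (suc b) n = distinct b n ++ prepend (suc b) (distinct b) n

-- The sentinel `suc b` in front expresses the order and the bound as one chain. Under the strict
-- order of `IsDistinct` the same sentinel means parts at most b.
record IsWithOnes (w b n : ℕ) (xs : Parts) : Set where
  constructor mk
  field
    bounded  : Linked _≥_ (suc b ∷ xs)
    positive : All (0 <_) xs
    ones     : ω xs ≡ w
    total    : sum xs ≡ n

record IsDistinct (b n : ℕ) (xs : Parts) : Set where
  constructor mk
  field
    bounded  : Linked _>_ (suc b ∷ xs)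
    positive : All (0 <_) xs
    total    : sum xs ≡ n

Linked-raise : ∀ {R : ℕ → ℕ → Set} {b c xs} → (∀ {x} → R b x → R c x) →
               Linked R (b ∷ xs) → Linked R (c ∷ xs)
Linked-raise r [-]        = [-]
Linked-raise r (bRx ∷ xs) = r bRx ∷ xs

IsWithOnes-raise : ∀ {w b n xs} → IsWithOnes w b n xs → IsWithOnes w (suc b) n xs
IsWithOnes-raise (mk bnd pos one tot) = mk (Linked-raise ℕₚ.m≤n⇒m≤1+n bnd) pos one tot

IsWithOnes-∷ : ∀ {w b n xs} → IsWithOnes w (suc b) n xs →
               IsWithOnes w (suc b) (2 + b + n) (2 + b ∷ xs)
IsWithOnes-∷ {b = b} (mk bnd pos one tot) =
  mk (ℕₚ.≤-refl ∷ bnd) (s≤s z≤n ∷ pos) one (cong (λ n → 2 + b + n) tot)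

replicate-isWithOnes : ∀ w → IsWithOnes w 0 w (replicate w 1)
replicate-isWithOnes zero    = mk [-] [] refl refl
replicate-isWithOnes (suc w) with replicate-isWithOnes w
... | mk bnd pos one tot = mk (ℕₚ.≤-refl ∷ bnd) (s≤s z≤n ∷ pos) (cong suc one) (cong suc tot)

withOnes-sound : ∀ w b n xs → xs ∈ withOnes w b n → IsWithOnes w b n xs
withOnes-sound w zero    n xs xs∈ with ∈-single⁻ w n xs∈
... | refl , refl = replicate-isWithOnes w
withOnes-sound w (suc b) = repeated-induction (2 + b) (withOnes w b) (IsWithOnes w (suc b))
  (λ n xs xs∈ → IsWithOnes-raise (withOnes-sound w b n xs xs∈)) (λ n xs → IsWithOnes-∷)

all-ones : ∀ xs → Linked _≥_ (1 ∷ xs) → All (0 <_) xs → ω xs ≡ sum xs × xs ≡ replicate (ω xs) 1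
all-ones []       _ _ = refl , refl
all-ones (1 ∷ xs) (_ ∷ lnk) (_ ∷ pos) with all-ones xs lnk pos
... | ω≡sum , xs≡ = cong suc ω≡sum , cong (1 ∷_) xs≡
all-ones (0 ∷ xs) _ (() ∷ _)
all-ones (suc (suc x) ∷ xs) (s≤s () ∷ _) _

withOnes-step : ∀ w b n {xs} → xs ∈ withOnes w b n ++ prepend (2 + b) (withOnes w (suc b)) n →
                xs ∈ withOnes w (suc b) n
withOnes-step w b n {xs} = subst (xs ∈_) (sym (repeated-unfold (suc b) (withOnes w b) n))

withOnes-mono : ∀ w b c n {xs} → b ≤ c → xs ∈ withOnes w b n → xs ∈ withOnes w c n
withOnes-mono w b c n b≤c xs∈ with ℕₚ.m≤n⇒m<n∨m≡n b≤c
... | inj₂ refl = xs∈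
withOnes-mono w b (suc c) n _ xs∈ | inj₁ (s≤s b≤c) =
  withOnes-step w c n (∈-++⁺ˡ (withOnes-mono w b c n b≤c xs∈))

-- A list first occurs at the level of its largest part, level 0 if no part exceeds 1, and is
-- carried up from there.
withOnes-complete : ∀ b xs → Linked _≥_ (suc b ∷ xs) → All (0 <_) xs → xs ∈ withOnes (ω xs) b (sum xs)
withOnes-complete b []       _ _ = withOnes-mono 0 0 b 0 z≤n (∈-single⁺ 0)
withOnes-complete b (0 ∷ xs) _ (() ∷ _)
withOnes-complete b xs@(1 ∷ xs′) (_ ∷ lnk) pos with all-ones xs (ℕₚ.≤-refl ∷ lnk) pos
... | ω≡sum , xs≡ = withOnes-mono (ω xs) 0 b (sum xs) z≤n
  (subst (λ n → xs ∈ withOnes (ω xs) 0 n) ω≡sum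
    (subst (λ ys → xs ∈ single (ω xs) ys (ω xs)) xs≡ (∈-single⁺ (ω xs))))
withOnes-complete b (suc (suc x) ∷ xs) (s≤s x<b ∷ lnk) (_ ∷ pos) =
  withOnes-mono (ω xs) (suc x) b (2 + x + sum xs) x<b (withOnes-step (ω xs) x (2 + x + sum xs)
    (∈-++⁺ʳ (withOnes (ω xs) x (2 + x + sum xs))
      (∈-prepend⁺ (2 + x) (sum xs) (withOnes-complete (suc x) xs lnk pos))))

∷-above : ∀ {w b n xs} → IsWithOnes w b n (2 + b ∷ xs) → ⊥
∷-above (mk (d≤ ∷ _) _ _ _) = contradiction d≤ ℕₚ.1+n≰n

withOnes-unique : ∀ w b n → Unique (withOnes w b n)
withOnes-unique w zero    n = single-unique w n
withOnes-unique w (suc b) n = repeated-unique (2 + b) (withOnes w b) n (withOnes-unique w b)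
  (λ m xs xs∈ → ∷-above (withOnes-sound w b m _ xs∈))

withoutOnes-sound : ∀ b n xs → xs ∈ withoutOnes b n → IsWithOnes 0 b n xs × xs ≢ []
withoutOnes-sound (suc b) n xs xs∈ with ∈-++⁻ (withoutOnes b n) xs∈
... | inj₁ xs∈′ with withoutOnes-sound b n xs xs∈′
...   | is , xs≢[] = IsWithOnes-raise is , xs≢[]
withoutOnes-sound (suc b) n xs xs∈ | inj₂ xs∈p with ∈-prepend⁻ (2 + b) n xs∈p
...   | m , ys , refl , refl , ys∈ = IsWithOnes-∷ (withOnes-sound 0 (suc b) m ys ys∈) , λ ()

withoutOnes-complete : ∀ b x xs → Linked _≥_ (suc b ∷ x ∷ xs) → All (0 <_) (x ∷ xs) → ω (x ∷ xs) ≡ 0 →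
                       x ∷ xs ∈ withoutOnes b (sum (x ∷ xs))
withoutOnes-complete zero 0 xs _ (() ∷ _)
withoutOnes-complete zero (suc (suc x)) xs (s≤s () ∷ _) _ _
withoutOnes-complete (suc b) x xs (x≤ ∷ lnk) pos ω≡0 with ℕₚ.m≤n⇒m<n∨m≡n x≤
... | inj₁ (s≤s x≤′) = ∈-++⁺ˡ (withoutOnes-complete b x xs (x≤′ ∷ lnk) pos ω≡0)
... | inj₂ refl      = ∈-++⁺ʳ (withoutOnes b (2 + b + sum xs)) (∈-prepend⁺ (2 + b) (sum xs)
  (subst (λ w → xs ∈ withOnes w (suc b) (sum xs)) ω≡0 (withOnes-complete (suc b) xs lnk (All.tail pos))))

withoutOnes-unique : ∀ b n → Unique (withoutOnes b n)
withoutOnes-unique zero    n = []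
withoutOnes-unique (suc b) n = ++-prepend-unique (2 + b) {withoutOnes b} n
  (withoutOnes-unique b) (withOnes-unique 0 (suc b))
  (λ xs xs∈ → ∷-above (proj₁ (withoutOnes-sound b n _ xs∈)))

distinct-sound : ∀ b n xs → xs ∈ distinct b n → IsDistinct b n xs
distinct-sound zero    n xs xs∈ with ∈-single⁻ 0 n xs∈
... | refl , refl = mk [-] [] refl
distinct-sound (suc b) n xs xs∈ with ∈-++⁻ (distinct b n) xs∈
... | inj₁ xs∈′ with distinct-sound b n xs xs∈′
...   | mk bnd pos tot = mk (Linked-raise ℕₚ.m<n⇒m<1+n bnd) pos tot
distinct-sound (suc b) n xs xs∈ | inj₂ xs∈p with ∈-prepend⁻ (suc b) n xs∈p
...   | m , ys , refl , refl , ys∈ with distinct-sound b m ys ys∈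
...     | mk bnd pos tot = mk (ℕₚ.≤-refl ∷ bnd) (s≤s z≤n ∷ pos) (cong (λ n → suc b + n) tot)

distinct-complete : ∀ b xs → Linked _>_ (suc b ∷ xs) → All (0 <_) xs → xs ∈ distinct b (sum xs)
distinct-complete zero    []       _          _           = ∈-single⁺ 0
distinct-complete zero    (x ∷ xs) (x<1 ∷ _)  (0<x ∷ _)   = contradiction (ℕₚ.<-≤-trans x<1 0<x) (ℕₚ.<-irrefl refl)
distinct-complete (suc b) []       _          pos         = ∈-++⁺ˡ (distinct-complete b [] [-] pos)
distinct-complete (suc b) (x ∷ xs) (x< ∷ lnk) pos with ℕₚ.m≤n⇒m<n∨m≡n (ℕ.s≤s⁻¹ x<)
... | inj₁ x<′  = ∈-++⁺ˡ (distinct-complete b (x ∷ xs) (x<′ ∷ lnk) pos)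
... | inj₂ refl = ∈-++⁺ʳ (distinct b (suc b + sum xs))
  (∈-prepend⁺ (suc b) (sum xs) (distinct-complete b xs lnk (All.tail pos)))

distinct-unique : ∀ b n → Unique (distinct b n)
distinct-unique zero    n = single-unique 0 n
distinct-unique (suc b) n = ++-prepend-unique (suc b) {distinct b} n (distinct-unique b) (distinct-unique b)
  (λ xs xs∈ → case distinct-sound b n _ xs∈ of λ { (mk (d< ∷ _) _ _) → contradiction d< (ℕₚ.<-irrefl refl) })

-- The non-empty partitions of n, complete for n ≤ N only.
nonempty : ℕ → ℕ → List Parts
nonempty N n = withoutOnes N n ++ ⋃≤ N (λ w → withOnes (suc w) N n)

-- Split, like `crank1`, by whether π₂ is empty. The bound `suc N` excludes no π₁ and is the one at
-- which `V` and `D` enter the final identity.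
overpartitions : ℕ → List (Parts × Parts)
overpartitions N = map (_, []) (distinct (suc N) N)
  ++ ⋃≤ N (λ i → cartesianProduct (distinct (suc N) i) (nonempty N (N ∸ i)))

nonempty-sound : ∀ N n xs → xs ∈ nonempty N n → (∃[ w ] IsWithOnes w N n xs) × xs ≢ []
nonempty-sound N n xs xs∈ with ∈-++⁻ (withoutOnes N n) xs∈
... | inj₁ xs∈′ with withoutOnes-sound N n xs xs∈′
...   | is , xs≢[] = (0 , is) , xs≢[]
nonempty-sound N n xs xs∈ | inj₂ xs∈⋃ with ∈-⋃≤⁻ N (λ w → withOnes (suc w) N n) xs∈⋃
...   | w , _ , xs∈w with withOnes-sound (suc w) N n xs xs∈w
...     | is = (suc w , is) , λ { refl → ℕₚ.0≢1+n (IsWithOnes.ones is) }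

ω≤sum : ∀ xs → ω xs ≤ sum xs
ω≤sum []           = z≤n
ω≤sum (0 ∷ xs)     = ω≤sum xs
ω≤sum (1 ∷ xs)     = s≤s (ω≤sum xs)
ω≤sum (suc (suc x) ∷ xs) = ℕₚ.≤-trans (ω≤sum xs) (ℕₚ.m≤n+m (sum xs) (2 + x))

nonempty-complete : ∀ N x xs → sum (x ∷ xs) ≤ N → Linked _≥_ (x ∷ xs) → All (0 <_) (x ∷ xs) →
                    x ∷ xs ∈ nonempty N (sum (x ∷ xs))
nonempty-complete N x xs sum≤N lnk pos with ω (x ∷ xs) in eq
... | zero  = ∈-++⁺ˡ (withoutOnes-complete N x xs bnd pos eq)
  where bnd = ℕₚ.m≤n⇒m≤1+n (ℕₚ.≤-trans (ℕₚ.m≤m+n x (sum xs)) sum≤N) ∷ lnk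
... | suc w = ∈-++⁺ʳ (withoutOnes N (sum (x ∷ xs))) (∈-⋃≤⁺ N w
    (ℕₚ.<⇒≤ (ℕₚ.≤-trans (ℕₚ.≤-trans (ℕₚ.≤-reflexive (sym eq)) (ω≤sum (x ∷ xs))) sum≤N))
    (subst (λ w → x ∷ xs ∈ withOnes w N (sum (x ∷ xs))) eq (withOnes-complete N (x ∷ xs) bnd pos)))
  where bnd = ℕₚ.m≤n⇒m≤1+n (ℕₚ.≤-trans (ℕₚ.m≤m+n x (sum xs)) sum≤N) ∷ lnk

nonempty-unique : ∀ N n → Unique (nonempty N n)
nonempty-unique N n = Uniqueₚ.++⁺ (withoutOnes-unique N n)
  (⋃≤-unique N _ (λ w → withOnes-unique (suc w) N n)
    (λ v w xs∈v xs∈w → ℕₚ.suc-injective (trans (sym (ones v xs∈v)) (ones w xs∈w))))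
  disjoint
  where
  ones : ∀ w {xs} → xs ∈ withOnes (suc w) N n → ω xs ≡ suc w
  ones w xs∈ = IsWithOnes.ones (withOnes-sound (suc w) N n _ xs∈)
  disjoint : Disjoint (withoutOnes N n) (⋃≤ N (λ w → withOnes (suc w) N n))
  disjoint (xs∈ , xs∈⋃) with ∈-⋃≤⁻ N (λ w → withOnes (suc w) N n) xs∈⋃
  ... | w , _ , xs∈w =
    ℕₚ.0≢1+n (trans (sym (IsWithOnes.ones (proj₁ (withoutOnes-sound N n _ xs∈)))) (ones w xs∈w))

overpartitions-sound : ∀ N xs ys → (xs , ys) ∈ overpartitions N →
  (Linked _>_ xs × All (0 <_) xs) × (Linked _≥_ ys × All (0 <_) ys) × sum xs + sum ys ≡ N
overpartitions-sound N xs ys p∈ with ∈-++⁻ (map (_, []) (distinct (suc N) N)) p∈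
... | inj₁ p∈m with ∈-map⁻ (_, []) p∈m
...   | _ , xs∈ , refl with distinct-sound (suc N) N xs xs∈
...     | mk bnd pos tot = (Linked.tail bnd , pos) , ([] , []) , trans (ℕₚ.+-identityʳ _) tot
overpartitions-sound N xs ys p∈ | inj₂ p∈⋃
  with ∈-⋃≤⁻ N (λ i → cartesianProduct (distinct (suc N) i) (nonempty N (N ∸ i))) p∈⋃
...   | i , i≤N , p∈× with ∈-cartesianProduct⁻ (distinct (suc N) i) (nonempty N (N ∸ i)) p∈×
...     | xs∈ , ys∈ with distinct-sound (suc N) i xs xs∈ | nonempty-sound N (N ∸ i) ys ys∈
...       | mk bnd pos refl | (_ , mk bnd′ pos′ _ tot′) , _ =
  (Linked.tail bnd , pos) , (Linked.tail bnd′ , pos′) , trans (cong (λ n → sum xs + n) tot′) (ℕₚ.m+[n∸m]≡n i≤N)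

>-bounded : ∀ {N xs} → sum xs ≤ N → Linked _>_ xs → Linked _>_ (2 + N ∷ xs)
>-bounded {xs = []}     _     _   = [-]
>-bounded {xs = x ∷ xs} sum≤N lnk =
  s≤s (ℕₚ.m≤n⇒m≤1+n (ℕₚ.≤-trans (ℕₚ.m≤m+n x (sum xs)) sum≤N)) ∷ lnk

overpartitions-complete : ∀ N xs ys → Linked _>_ xs → All (0 <_) xs → Linked _≥_ ys → All (0 <_) ys →
                          sum xs + sum ys ≡ N → (xs , ys) ∈ overpartitions N
overpartitions-complete N xs [] lnk pos _ _ tot = ∈-++⁺ˡ (∈-map⁺ (_, [])
  (subst (λ n → xs ∈ distinct (suc N) n) sum≡N
    (distinct-complete (suc N) xs (>-bounded (ℕₚ.≤-reflexive sum≡N) lnk) pos)))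
  where sum≡N = trans (sym (ℕₚ.+-identityʳ (sum xs))) tot
overpartitions-complete N xs (y ∷ ys) lnk pos lnk′ pos′ refl =
  ∈-++⁺ʳ (map (_, []) (distinct (suc N) N)) (∈-⋃≤⁺ N (sum xs) sum≤N (∈-cartesianProduct⁺
    (distinct-complete (suc N) xs (>-bounded sum≤N lnk) pos)
    (subst (λ n → y ∷ ys ∈ nonempty N n) (sym (ℕₚ.m+n∸m≡n (sum xs) (sum (y ∷ ys))))
      (nonempty-complete N y ys (ℕₚ.m≤n+m (sum (y ∷ ys)) (sum xs)) lnk′ pos′))))
  where sum≤N = ℕₚ.m≤m+n (sum xs) (sum (y ∷ ys))

overpartitions-unique : ∀ N → Unique (overpartitions N)
overpartitions-unique N = Uniqueₚ.++⁺
  (Uniqueₚ.map⁺ (cong proj₁) (distinct-unique (suc N) N))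
  (⋃≤-unique N _ (λ i → Uniqueₚ.cartesianProduct⁺ (distinct-unique (suc N) i) (nonempty-unique N (N ∸ i)))
    (λ i j p∈i p∈j → trans (sym (total i p∈i)) (total j p∈j)))
  disjoint
  where
  total : ∀ i {p} → p ∈ cartesianProduct (distinct (suc N) i) (nonempty N (N ∸ i)) → sum (proj₁ p) ≡ i
  total i p∈ = IsDistinct.total (distinct-sound (suc N) i _
    (proj₁ (∈-cartesianProduct⁻ (distinct (suc N) i) (nonempty N (N ∸ i)) p∈)))
  disjoint : Disjoint (map (_, []) (distinct (suc N) N))
                      (⋃≤ N (λ i → cartesianProduct (distinct (suc N) i) (nonempty N (N ∸ i))))
  disjoint (p∈m , p∈⋃) with ∈-map⁻ (_, []) p∈m
  ... | _ , _ , refl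
    with ∈-⋃≤⁻ N (λ i → cartesianProduct (distinct (suc N) i) (nonempty N (N ∸ i))) p∈⋃
  ...   | i , _ , p∈× =
    proj₂ (nonempty-sound N (N ∸ i) []
      (proj₂ (∈-cartesianProduct⁻ (distinct (suc N) i) (nonempty N (N ∸ i)) p∈×))) refl

-- Generating functions of the enumerations

gf : ∀ {A : Set} → (A → ℤ) → List A → Laurent
gf s = map (λ x → 1ℤ , s x)

GF : ∀ {A : Set} → (A → ℤ) → (ℕ → List A) → Series
GF s f n = gf s (f n)

gf-++ : ∀ {A : Set} (s : A → ℤ) xs ys → gf s (xs ++ ys) ≈ᴸ gf s xs +ᴸ gf s ys
gf-++ s xs ys = ᴸ.reflexive (Listₚ.map-++ _ xs ys)

gf-scale : ∀ {A B : Set} (s : B → ℤ) (t : A → ℤ) v (h : A → B) xs →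
           (∀ {x} → x ∈ xs → s (h x) ≡ v ℤ.+ t x) → gf s (map h xs) ≈ᴸ z^ v *ᴸ gf t xs
gf-scale s t v h []       eq = ᴸ.refl
gf-scale s t v h (x ∷ xs) eq =
  ᴸ.+-cong (ᴸ.reflexive (cong (λ e → (1ℤ , e) ∷ []) (eq (here refl))))
           (gf-scale s t v h xs (eq ∘ there))

gf-cong : ∀ {A : Set} {s t : A → ℤ} xs → (∀ {x} → x ∈ xs → s x ≡ t x) → gf s xs ≡ gf t xs
gf-cong []       eq = refl
gf-cong (x ∷ xs) eq = cong₂ (λ e p → (1ℤ , e) ∷ p) (eq (here refl)) (gf-cong xs (eq ∘ there))

gf-⋃≤ : ∀ {A : Set} (s : A → ℤ) n f → gf s (⋃≤ n f) ≡ Σᴸ≤ n (gf s ∘ f)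
gf-⋃≤ s zero    f = refl
gf-⋃≤ s (suc n) f = trans (Listₚ.map-++ _ (⋃≤ n f) (f (suc n))) (cong (_++ gf s (f (suc n))) (gf-⋃≤ s n f))

gf-cartesianProduct : ∀ {A B : Set} (s : B → ℤ) (xs : List A) ys →
  gf (s ∘ proj₂) (cartesianProduct xs ys) ≈ᴸ gf (λ _ → 0ℤ) xs *ᴸ gf s ys
gf-cartesianProduct s []       ys = ᴸ.refl
gf-cartesianProduct s (x ∷ xs) ys = begin
  gf (s ∘ proj₂) (map (x ,_) ys ++ cartesianProduct xs ys)
    ≈⟨ gf-++ (s ∘ proj₂) (map (x ,_) ys) _ ⟩
  gf (s ∘ proj₂) (map (x ,_) ys) +ᴸ gf (s ∘ proj₂) (cartesianProduct xs ys)
    ≈⟨ ᴸ.+-cong (gf-scale (s ∘ proj₂) s 0ℤ (x ,_) ys (λ {y} _ → sym (ℤₚ.+-identityˡ (s y))))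
                (gf-cartesianProduct s xs ys) ⟩
  z^ 0ℤ *ᴸ gf s ys +ᴸ gf (λ _ → 0ℤ) xs *ᴸ gf s ys
    ≈⟨ ᴸ.distribʳ (gf s ys) (z^ 0ℤ) (gf (λ _ → 0ℤ) xs) ⟨
  gf (λ _ → 0ℤ) (x ∷ xs) *ᴸ gf s ys ∎
  where open ᴸ-Reasoning

GF-shift : ∀ {A : Set} (s : A → ℤ) v k f F → (∀ n → gf s (f n) ≈ᴸ z^ v *ᴸ F n) →
           ∀ n → gf s (shift k f n) ≈ᴸ ((z^ v q^ k) *ˢ F) n
GF-shift s v zero    f F eq n       = ᴸ.trans (eq n) (ᴸ.sym (monomial-0-* v F n))
GF-shift s v (suc k) f F eq zero    = ᴸ.refl
GF-shift s v (suc k) f F eq (suc n) = ᴸ.trans (GF-shift s v k f F eq n) (ᴸ.sym (*ˢ-sucˡ n (z^ v q^ suc k) F))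

GF-single : ∀ {A : Set} (s : A → ℤ) k x n → gf s (single k x n) ≈ᴸ (z^ (s x) q^ k) n
GF-single s zero    x zero    = ᴸ.refl
GF-single s zero    x (suc n) = ᴸ.refl
GF-single s (suc k) x zero    = ᴸ.refl
GF-single s (suc k) x (suc n) = GF-single s k x n

GF-prepend : ∀ (s t : Parts → ℤ) v d g → (∀ n {xs} → xs ∈ g n → s (d ∷ xs) ≡ v ℤ.+ t xs) →
             ∀ n → gf s (prepend d g n) ≈ᴸ ((z^ v q^ d) *ˢ GF t g) n
GF-prepend s t v d g eq = GF-shift s v d (map (d ∷_) ∘ g) (GF t g) (λ n → gf-scale s t v (d ∷_) (g n) (eq n))

-- Fixing the number of ones separately lets two lists with equally many ones be compared through
-- their filters alone.
crankWith : ℕ → Parts → ℤ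
crankWith w xs = if does (w ℕₚ.≟ 0) then + largest xs else + length (filter (w ℕₚ.<?_) xs) ℤ.- + w

crank≡crankWith : ∀ {w} xs → ω xs ≡ w → crank xs ≡ crankWith w xs
crank≡crankWith xs refl = refl

crank-replicate : ∀ w → crank (replicate (suc w) 1) ≡ -[1+ w ]
crank-replicate w = trans
  (crank≡crankWith (replicate (suc w) 1) (IsWithOnes.ones (replicate-isWithOnes (suc w))))
  (cong (λ xs → + length xs ℤ.- + suc w)
    (Listₚ.filter-none (suc w ℕₚ.<?_) {xs = replicate (suc w) 1} (Allₚ.replicate⁺ (suc w) λ { (s≤s ()) })))

-- A part of size at least 2 leaves `ω` unchanged and affects the crank only through `μ`, which
-- counts it just when it exceeds the number of ones; the next lemma is the other case.
crank-∷-≤ : ∀ {w} d xs → ω xs ≡ suc w → 2 + d ≤ suc w → crank (2 + d ∷ xs) ≡ 0ℤ ℤ.+ crank xs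
crank-∷-≤ {w} d xs ω≡ d≤w = trans (crank≡crankWith (2 + d ∷ xs) ω≡)
  (trans (cong (λ ys → + length ys ℤ.- + suc w) (Listₚ.filter-reject (suc w ℕₚ.<?_) {2 + d} {xs} (ℕₚ.≤⇒≯ d≤w)))
    (sym (trans (ℤₚ.+-identityˡ _) (crank≡crankWith xs ω≡))))

crank-∷-> : ∀ {w} d xs → ω xs ≡ suc w → suc w < 2 + d → crank (2 + d ∷ xs) ≡ 1ℤ ℤ.+ crank xs
crank-∷-> {w} d xs ω≡ w<d = trans (crank≡crankWith (2 + d ∷ xs) ω≡)
  (trans (cong (λ ys → + length ys ℤ.- + suc w) (Listₚ.filter-accept (suc w ℕₚ.<?_) {2 + d} {xs} w<d))
    (trans (ℤₚ.+-assoc 1ℤ (+ length (filter (suc w ℕₚ.<?_) xs)) (ℤ.- + suc w))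
      (cong (λ i → 1ℤ ℤ.+ i) (sym (crank≡crankWith xs ω≡)))))

largest-∷ : ∀ d xs → All (_≤ d) xs → largest (d ∷ xs) ≡ d
largest-∷ d xs xs≤d = max≈v⁺ (here refl) (ℕₚ.≤-refl ∷ xs≤d) z≤n

crank-withoutOnes : ∀ d xs → ω (d ∷ xs) ≡ 0 → Linked _≥_ (d ∷ xs) → crank (d ∷ xs) ≡ + d ℤ.+ 0ℤ
crank-withoutOnes d xs ω≡0 lnk = trans (crank≡crankWith (d ∷ xs) ω≡0)
  (trans (cong +_ (largest-∷ d xs (All.tail (Linkedₚ.Linked⇒All (λ p q → ℕₚ.≤-trans q p) ℕₚ.≤-refl lnk))))
    (sym (ℤₚ.+-identityʳ (+ d))))

lamWith : ℕ → Parts → ℤ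
lamWith ℓ xs = if does (_∈?_ ℕₚ._≟_ ℓ xs ×-dec _∈?_ ℕₚ._≟_ (ℓ ∸ 1) xs) then 0ℤ else 1ℤ

lam≡lamWith : ∀ d xs → Linked _>_ (suc d ∷ xs) → lam (suc d ∷ xs) ≡ lamWith (suc d) (suc d ∷ xs)
lam≡lamWith d xs lnk = cong (λ ℓ → lamWith ℓ (suc d ∷ xs))
  (largest-∷ (suc d) xs (All.tail (Linkedₚ.Linked⇒All (λ p q → ℕₚ.≤-trans q p) ℕₚ.≤-refl (Linked.map ℕₚ.<⇒≤ lnk))))

lam-0 : ∀ d xs → Linked _>_ (suc d ∷ d ∷ xs) → lam (suc d ∷ d ∷ xs) ≡ 0ℤ
lam-0 d xs lnk = trans (lam≡lamWith d (d ∷ xs) lnk)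
  (cong (if_then 0ℤ else 1ℤ) (dec-true (_∈?_ ℕₚ._≟_ (suc d) ys ×-dec _∈?_ ℕₚ._≟_ d ys)
    (here refl , there (here refl))))
  where ys = suc d ∷ d ∷ xs

-- The chain says that all other parts lie below d, so d is absent. For d = 0 it forces `xs` to be
-- empty, which is the single part 1.
lam-1 : ∀ d xs → Linked _>_ (d ∷ xs) → lam (suc d ∷ xs) ≡ 1ℤ
lam-1 d xs lnk = trans (lam≡lamWith d xs (Linked-raise ℕₚ.m<n⇒m<1+n lnk))
  (cong (if_then 0ℤ else 1ℤ) (dec-false (_∈?_ ℕₚ._≟_ (suc d) ys ×-dec _∈?_ ℕₚ._≟_ d ys) λ
    { (_ , here d≡1+d) → ℕₚ.1+n≢n (sym d≡1+d)
    ; (_ , there d∈xs) → ℕₚ.<-irrefl refl (All.lookup xs<d d∈xs) }))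
  where
  ys = suc d ∷ xs
  xs<d : All (_< d) xs
  xs<d = below xs lnk
    where
    below : ∀ xs → Linked _>_ (d ∷ xs) → All (_< d) xs
    below []       _           = []
    below (x ∷ xs) (x<d ∷ lnk) = Linkedₚ.Linked⇒All (λ p q → ℕₚ.<-trans q p) x<d lnk

-- `crank1` on bare lists, so that enumeration and filtering carry no proofs.
stat : Parts × Parts → ℤ
stat (xs , [])         = lam xs
stat (xs , ys@(_ ∷ _)) = crank ys

stat-nonempty : ∀ xs {ys} → ys ≢ [] → stat (xs , ys) ≡ crank ys
stat-nonempty xs {[]}    ys≢[] = contradiction refl ys≢[]
stat-nonempty xs {_ ∷ _} _     = refl

-- Recurrences of the generating functions, and the identity for M̄

module Recurrences (N : ℕ) where

  open Truncated N hiding (isCommutativeRing)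
  open Quotients N
  open Pochhammer commutativeRing using (poch; poch-cong; Σ≤; module CrankIdentity)
  open import Algebra.Properties.Semiring.Exp ˢ.semiring using (_^_)

  z₁ z₋₁ : Series
  z₁  = z^ 1ℤ q^ 0
  z₋₁ = z^ -[1+ 0 ] q^ 0

  mono-* : ∀ d j e k → (z^ d q^ j) *ˢ (z^ e q^ k) ≈ˢ (z^ (d ℤ.+ e) q^ (j + k))
  mono-* d j e k = mk λ n _ → monomial-* d j e k n

  q^≈ : ∀ k → q ^ k ≈ˢ (z^ 0ℤ q^ k)
  q^≈ zero    = ˢ.refl
  q^≈ (suc k) = ˢ.trans (ˢ.*-congˡ {q} (q^≈ k)) (mono-* 0ℤ 1 0ℤ k)

  zq^≈ : ∀ k → z₁ *ˢ q ^ k ≈ˢ (z^ 1ℤ q^ k)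
  zq^≈ k = ˢ.trans (ˢ.*-congˡ {z₁} (q^≈ k)) (mono-* 1ℤ 0 0ℤ k)

  [zq]^≈ : ∀ k → (z₁ *ˢ q) ^ k ≈ˢ (z^ (+ k) q^ k)
  [zq]^≈ zero    = ˢ.refl
  [zq]^≈ (suc k) = ˢ.trans (ˢ.*-cong (mono-* 1ℤ 0 0ℤ 1) ([zq]^≈ k)) (mono-* 1ℤ 1 (+ k) k)

  [z⁻¹q]^≈ : ∀ k → (z₋₁ *ˢ q) ^ k ≈ˢ (z^ (ℤ.- + k) q^ k)
  [z⁻¹q]^≈ zero    = ˢ.refl
  [z⁻¹q]^≈ (suc k) = ˢ.trans (ˢ.*-cong (mono-* -[1+ 0 ] 0 0ℤ 1) ([z⁻¹q]^≈ k))
    (ˢ.trans (mono-* -[1+ 0 ] 1 (ℤ.- + k) k) (ˢ.reflexive (cong (λ e → z^ e q^ suc k) (-1-k k))))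
    where
    -1-k : ∀ k → -[1+ 0 ] ℤ.+ (ℤ.- + k) ≡ ℤ.- + suc k
    -1-k zero    = refl
    -1-k (suc k) = refl

  e D V L : ℕ → Series
  e b = GF (λ _ → 0ℤ) (withOnes 0 b)
  D b = GF (λ _ → 0ℤ) (distinct b)
  V b = GF lam (distinct b)
  L b = GF crank (withoutOnes b)

  X : ℕ → ℕ → Series
  X w b = GF crank (withOnes (suc w) b)

  withOnes-rec : ∀ s v w b → (∀ n {xs} → xs ∈ withOnes w (suc b) n → s (2 + b ∷ xs) ≡ v ℤ.+ s xs) →
    GF s (withOnes w (suc b)) ≈ˢ GF s (withOnes w b) +ˢ (z^ v q^ (2 + b)) *ˢ GF s (withOnes w (suc b))
  withOnes-rec s v w b eq = mk λ n _ → ᴸ.trans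
    (ᴸ.reflexive (cong (gf s) (repeated-unfold (suc b) (withOnes w b) n)))
    (ᴸ.trans (gf-++ s (withOnes w b n) _)
      (ᴸ.+-congˡ {gf s (withOnes w b n)} (GF-prepend s s v (2 + b) (withOnes w (suc b)) eq n)))

  scale : ∀ f {m m′} g → m ≈ˢ m′ → f +ˢ m *ˢ g ≈ˢ f +ˢ m′ *ˢ g
  scale f g m≈ = ˢ.+-congˡ {f} (ˢ.*-congʳ {g} m≈)

  e-suc : ∀ b → e (suc b) ≈ˢ e b +ˢ q ^ (2 + b) *ˢ e (suc b)
  e-suc b = ˢ.trans (withOnes-rec _ 0ℤ 0 b (λ _ _ → refl)) (scale (e b) (e (suc b)) (ˢ.sym (q^≈ (2 + b))))

  X-0 : ∀ w → X w 0 ≈ˢ (z₋₁ *ˢ q) ^ suc w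
  X-0 w = ˢ.trans (mk λ n _ → GF-single crank (suc w) (replicate (suc w) 1) n)
    (ˢ.trans (ˢ.reflexive (cong (λ e → z^ e q^ suc w) (crank-replicate w))) (ˢ.sym ([z⁻¹q]^≈ (suc w))))

  X-suc-< : ∀ w b → b < w → X w (suc b) ≈ˢ X w b +ˢ q ^ (2 + b) *ˢ X w (suc b)
  X-suc-< w b b<w = ˢ.trans
    (withOnes-rec crank 0ℤ (suc w) b (λ n {xs} xs∈ →
      crank-∷-≤ b xs (IsWithOnes.ones (withOnes-sound (suc w) (suc b) n xs xs∈)) (s≤s b<w)))
    (scale (X w b) (X w (suc b)) (ˢ.sym (q^≈ (2 + b))))

  X-suc-≥ : ∀ w b → w ≤ b → X w (suc b) ≈ˢ X w b +ˢ z₁ *ˢ q ^ (2 + b) *ˢ X w (suc b)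
  X-suc-≥ w b w≤b = ˢ.trans
    (withOnes-rec crank 1ℤ (suc w) b (λ n {xs} xs∈ →
      crank-∷-> b xs (IsWithOnes.ones (withOnes-sound (suc w) (suc b) n xs xs∈)) (s≤s (s≤s w≤b))))
    (scale (X w b) (X w (suc b)) (ˢ.sym (zq^≈ (2 + b))))

  L-suc : ∀ b → L (suc b) ≈ˢ L b +ˢ (z₁ *ˢ q) ^ (2 + b) *ˢ e (suc b)
  L-suc b = ˢ.trans
    (mk λ n _ → ᴸ.trans (gf-++ crank (withoutOnes b n) _) (ᴸ.+-congˡ {gf crank (withoutOnes b n)}
      (GF-prepend crank (λ _ → 0ℤ) (+ (2 + b)) (2 + b) (withOnes 0 (suc b)) crank≡ n)))
    (scale (L b) (e (suc b)) (ˢ.sym ([zq]^≈ (2 + b))))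
    where
    crank≡ : ∀ n {xs} → xs ∈ withOnes 0 (suc b) n → crank (2 + b ∷ xs) ≡ + (2 + b) ℤ.+ 0ℤ
    crank≡ n {xs} xs∈ with withOnes-sound 0 (suc b) n xs xs∈
    ... | mk bnd _ ω≡0 _ = crank-withoutOnes (2 + b) xs ω≡0 bnd

  D-0 : D 0 ≈ˢ 1ˢ
  D-0 = mk λ n _ → GF-single (λ _ → 0ℤ) 0 [] n

  distinct-rec : ∀ s t v b → (∀ n {xs} → xs ∈ distinct b n → s (suc b ∷ xs) ≡ v ℤ.+ t xs) →
    GF s (distinct (suc b)) ≈ˢ GF s (distinct b) +ˢ (z^ v q^ suc b) *ˢ GF t (distinct b)
  distinct-rec s t v b eq = mk λ n _ → ᴸ.trans (gf-++ s (distinct b n) _)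
    (ᴸ.+-congˡ {gf s (distinct b n)} (GF-prepend s t v (suc b) (distinct b) eq n))

  D-suc : ∀ b → D (suc b) ≈ˢ D b +ˢ q ^ suc b *ˢ D b
  D-suc b = ˢ.trans (distinct-rec _ _ 0ℤ b (λ _ _ → refl)) (scale (D b) (D b) (ˢ.sym (q^≈ (suc b))))

  V-1 : V 1 ≈ˢ 1ˢ +ˢ z₁ *ˢ q
  V-1 = ˢ.trans
    (distinct-rec lam (λ _ → 0ℤ) 1ℤ 0 (λ n xs∈ → cong (λ xs → lam (1 ∷ xs)) (proj₂ (∈-single⁻ 0 n xs∈))))
    (ˢ.+-cong (mk λ n _ → GF-single lam 0 [] n)
      (ˢ.trans (ˢ.*-cong (ˢ.sym (mono-* 1ℤ 0 0ℤ 1)) D-0) (ˢ.*-identityʳ (z₁ *ˢ q))))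

  -- Under the largest part 2 + b, the part 1 + b is either absent, giving λ = 1 and `z₁ *ˢ D b`, or
  -- present, giving λ = 0 and the factor q^(1 + b).
  V-suc : ∀ b → V (2 + b) ≈ˢ V (suc b) +ˢ q ^ (2 + b) *ˢ (z₁ *ˢ D b +ˢ q ^ suc b *ˢ D b)
  V-suc b = ˢ.trans
    (distinct-rec lam lam′ 0ℤ (suc b) (λ n {xs} _ → sym (ℤₚ.+-identityˡ (lam′ xs))))
    (ˢ.+-congˡ {V (suc b)} (ˢ.*-cong (ˢ.sym (q^≈ (2 + b)))
      (ˢ.trans (distinct-rec lam′ (λ _ → 0ℤ) 0ℤ b λ′-0)
        (ˢ.+-cong (mk λ n _ → λ′-1 n) (ˢ.*-congʳ {D b} (ˢ.sym (q^≈ (suc b))))))))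
    where
    lam′ : Parts → ℤ
    lam′ xs = lam (2 + b ∷ xs)
    λ′-0 : ∀ n {xs} → xs ∈ distinct b n → lam′ (suc b ∷ xs) ≡ 0ℤ
    λ′-0 n {xs} xs∈ = lam-0 (suc b) xs (ℕₚ.≤-refl ∷ IsDistinct.bounded (distinct-sound b n xs xs∈))
    λ′-1 : ∀ n → gf lam′ (distinct b n) ≈ᴸ (z₁ *ˢ D b) n
    λ′-1 n = ᴸ.trans
      (ᴸ.reflexive (cong (gf lam′) (sym (Listₚ.map-id (distinct b n)))))
      (ᴸ.trans (gf-scale lam′ (λ _ → 0ℤ) 1ℤ (λ xs → xs) (distinct b n) (λ {xs} xs∈ →
          lam-1 (suc b) xs (IsDistinct.bounded (distinct-sound b n xs xs∈))))
        (ᴸ.sym (monomial-0-* 1ℤ (D b) n)))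

  zz⁻¹≈1 : z₁ *ˢ z₋₁ ≈ˢ 1ˢ
  zz⁻¹≈1 = mono-* 1ℤ 0 -[1+ 0 ] 0

  q^1+N≈0 : q ^ suc N ≈ˢ 0ˢ
  q^1+N≈0 = ˢ.trans (q^≈ (suc N)) (mk λ n n≤N → monomial-vanish 0ℤ (suc N) n (s≤s n≤N))

  open CrankIdentity N q z₁ z₋₁ zz⁻¹≈1 q^1+N≈0
    e (mk λ n _ → GF-single (λ _ → 0ℤ) 0 [] n) e-suc
    L ˢ.refl L-suc
    X X-0 X-suc-< X-suc-≥
    D D-0 D-suc V V-1 V-suc
    using (K; overpartition-identity)

  K-at : ∀ n → gf crank (nonempty N n) ≡ K n
  K-at n = trans (Listₚ.map-++ _ (withoutOnes N n) _) (cong (L N n ++_)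
    (trans (gf-⋃≤ crank N (λ w → withOnes (suc w) N n)) (go N)))
    where
    go : ∀ m → Σᴸ≤ m (λ w → X w N n) ≡ Σ≤ m (λ w → X w N) n
    go zero    = refl
    go (suc m) = cong (_++ X (suc m) N n) (go m)

  gf-overpartitions : gf stat (overpartitions N) ≈ᴸ (V (suc N) +ˢ D (suc N) *ˢ K) N
  gf-overpartitions = ᴸ.trans
    (gf-++ stat (map (_, []) (distinct (suc N) N)) _)
    (ᴸ.+-cong
      (ᴸ.reflexive (sym (Listₚ.map-∘ (distinct (suc N) N))))
      (ᴸ.trans (ᴸ.reflexive (gf-⋃≤ stat N products)) (Σᴸ≤-cong N (λ i _ → product i))))
    where
    products : ℕ → List (Parts × Parts)
    products i = cartesianProduct (distinct (suc N) i) (nonempty N (N ∸ i))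
    product : ∀ i → gf stat (products i) ≈ᴸ D (suc N) i *ᴸ K (N ∸ i)
    product i = ᴸ.trans
      (ᴸ.reflexive (gf-cong (products i) (λ {p} p∈ → stat-nonempty (proj₁ p)
        (proj₂ (nonempty-sound N (N ∸ i) (proj₂ p)
          (proj₂ (∈-cartesianProduct⁻ (distinct (suc N) i) (nonempty N (N ∸ i)) p∈)))))))
      (ᴸ.trans (gf-cartesianProduct crank (distinct (suc N) i) (nonempty N (N ∸ i)))
        (ᴸ.*-congˡ {D (suc N) i} (ᴸ.reflexive (K-at (N ∸ i)))))

  M̄-series≈ : M̄-series ≈ˢ V (suc N) +ˢ D (suc N) *ˢ K
  M̄-series≈ = /ˢ-unique ⟨ q² ⨾ q² ⟩∞ (⟨ zq ⨾ q ⟩∞ *ˢ ⟨ z⁻¹q ⨾ q ⟩∞) (V (suc N) +ˢ D (suc N) *ˢ K) ᴸ.refl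
    (ˢ.trans (ˢ.*-congˡ {V (suc N) +ˢ D (suc N) *ˢ K} (ˢ.*-cong
        (ˢ.trans (⟨⨾⟩∞≈poch zq q ᴸ.refl) (poch-cong {b = q} (ˢ.sym (mono-* 1ℤ 0 0ℤ 1)) ˢ.refl (suc N)))
        (ˢ.trans (⟨⨾⟩∞≈poch z⁻¹q q ᴸ.refl) (poch-cong {b = q} (ˢ.sym (mono-* -[1+ 0 ] 0 0ℤ 1)) ˢ.refl (suc N)))))
      (ˢ.trans overpartition-identity
        (ˢ.sym (ˢ.trans (⟨⨾⟩∞≈poch q² q² ᴸ.refl) (poch-cong qq qq (suc N))))))
    where
    qq : q² ≈ˢ q *ˢ q
    qq = ˢ.sym (mono-* 0ℤ 1 0ℤ 1)

-- From coefficients to a bijection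

gf-coefficient : ∀ {A : Set} (s : A → ℤ) m xs → + length (filter (λ x → s x ℤₚ.≟ m) xs) ≡ [z^ m ] (gf s xs)
gf-coefficient s m []       = refl
gf-coefficient s m (x ∷ xs) with s x ℤₚ.≟ m
... | yes _ = cong (λ i → 1ℤ ℤ.+ i) (gf-coefficient s m xs)
... | no  _ = gf-coefficient s m xs

lookup-injective : ∀ {A : Set} {xs : List A} → Unique xs → ∀ i j → lookup xs i ≡ lookup xs j → i ≡ j
lookup-injective (x∉ ∷ u) zero    zero    eq = refl
lookup-injective {xs = _ ∷ xs} (x∉ ∷ u) zero    (suc j) eq = contradiction eq (All.lookup x∉ (∈-lookup j))
lookup-injective {xs = _ ∷ xs} (x∉ ∷ u) (suc i) zero    eq = contradiction (sym eq) (All.lookup x∉ (∈-lookup i))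
lookup-injective (x∉ ∷ u) (suc i) (suc j) eq = cong suc (lookup-injective u i j eq)

enumeration↔ : ∀ {A B : Set} (xs : List A) → Unique xs → (f : B → A) → (∀ {b c} → f b ≡ f c → b ≡ c) →
               (∀ b → f b ∈ xs) → (∀ {x} → x ∈ xs → ∃[ b ] f b ≡ x) → Fin (length xs) ↔ B
enumeration↔ xs xs! f f-inj f∈ f-sur = mk↔ₛ′
  (λ i → proj₁ (f-sur (∈-lookup {xs = xs} i)))
  (λ b → Any.index (f∈ b))
  (λ b → f-inj (trans (proj₂ (f-sur (∈-lookup {xs = xs} (Any.index (f∈ b))))) (sym (Anyₚ.lookup-index (f∈ b)))))
  (λ i → lookup-injective xs! _ i
    (trans (sym (Anyₚ.lookup-index (f∈ _))) (proj₂ (f-sur (∈-lookup {xs = xs} i)))))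

parts² : Overpartition → Parts × Parts
parts² (π₁ , π₂) = DistinctPartition.parts π₁ , Partition.parts π₂

-- Positivity and order are proof-irrelevant, so the parts determine the overpartition.
parts²-injective : ∀ {π ρ} → parts² π ≡ parts² ρ → π ≡ ρ
parts²-injective {mkDistinctPartition xs p d , mkPartition ys p′ d′}
                 {mkDistinctPartition _ r e , mkPartition _ r′ e′} refl = cong₂ _,_
  (cong₂ (mkDistinctPartition xs) (All.irrelevant ℕₚ.≤-irrelevant p r) (Linked.irrelevant ℕₚ.≤-irrelevant d e))
  (cong₂ (mkPartition ys) (All.irrelevant ℕₚ.≤-irrelevant p′ r′) (Linked.irrelevant ℕₚ.≤-irrelevant d′ e′))

crank1≡stat : ∀ π → crank1 π ≡ stat (parts² π)
crank1≡stat (π₁ , mkPartition []      _ _) = refl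
crank1≡stat (π₁ , mkPartition (_ ∷ _) _ _) = refl

theorem1p2 : (n : ℕ) (m : ℤ) →
    Σ[ k ∈ ℕ ] ((Fin k ↔ OverpartitionsOf n WithCrank1 m) × (+ k ≡ M̄ m n))
theorem1p2 n m = length selected , enumeration↔ selected selected-unique raw raw-injective raw∈ realise , count
  where
  stat≟m : ∀ p → _
  stat≟m p = stat p ℤₚ.≟ m

  selected : List (Parts × Parts)
  selected = filter stat≟m (overpartitions n)

  selected-unique : Unique selected
  selected-unique = Uniqueₚ.filter⁺ stat≟m (overpartitions-unique n)

  raw : OverpartitionsOf n WithCrank1 m → Parts × Parts
  raw (π , _) = parts² π

  raw-injective : ∀ {a b} → raw a ≡ raw b → a ≡ b
  raw-injective {π , s , c} {ρ , s′ , c′} eq with parts²-injective {π} {ρ} eq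
  ... | refl = cong₂ (λ s c → π , s , c) (ℕₚ.≡-irrelevant s s′) (Decidable⇒UIP.≡-irrelevant ℤₚ._≟_ c c′)

  raw∈ : ∀ a → raw a ∈ selected
  raw∈ (π@(mkDistinctPartition xs p d , mkPartition ys p′ d′) , s , c) =
    ∈-filter⁺ stat≟m (overpartitions-complete n xs ys d p d′ p′ s) (trans (sym (crank1≡stat π)) c)

  realise : ∀ {p} → p ∈ selected → ∃[ a ] raw a ≡ p
  realise {xs , ys} p∈ with ∈-filter⁻ stat≟m {xs = overpartitions n} p∈
  ... | p∈o , c with overpartitions-sound n xs ys p∈o
  ...   | (d , p) , (d′ , p′) , s = (π , s , trans (crank1≡stat π) c) , refl
    where
    π : Overpartition
    π = mkDistinctPartition xs p d , mkPartition ys p′ d′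

  count : + length selected ≡ M̄ m n
  count = trans (gf-coefficient stat m (overpartitions n))
    ([z^]-cong m (ᴸ.trans gf-overpartitions (ᴸ.sym (Truncated.coefficient M̄-series≈ n ℕₚ.≤-refl))))
    where open Recurrences n
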